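{- Let $H$ be an $n$-vertex simple graph with minimum degree at least $h$. There exists a collection $\mathcal F=\{K_1,\dots,K_t\}$ of vertex-disjoint induced subgraphs of $H$ (called expanding cores), where $t=O((n\log n)/h)$, such that, for some $\phi=\Omega(1/\log n)$: (1) each $K\in\mathcal F$ is a $\phi$-expander with $\deg_K(u)\ge\phi h/3$ for all $u\in V(K)$; moreover, $K$ has diameter $O((\log n)/\phi)$ and is $(\phi h/3)$-edge-connected; (2) for each vertex $u\notin\bigcup_{K\in\mathcal F}V(K)$, there are at least $2h/3$ edge-disjoint paths, each of length $O(\log n)$, from $u$ to vertices in $\bigcup_{K\in\mathcal F}V(K)$.
   Context: For $S\subseteq V(K)$, $\delta_K(S)$ is the number of edges of $K$ with exactly one endpoint in $S$, and $\mathrm{vol}_K(S)=\sum_{v\in S}\deg_K(v)$. $K$ is a $\phi$-expander if for every $S$ with $1\le|S|<|V(K)|$, $\delta_K(S)/\min\{\mathrm{vol}_K(S),\mathrm{vol}_K(V(K)\setminus S)\}\ge\phi$. Path length is the number of edges. -}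

module Defs where

open import Data.Nat using (ℕ; zero; suc; _+_; _*_; _≤_; _<_; _⊓_)
open import Data.Bool using (Bool; true; false; _∧_; not; if_then_else_; T)
open import Data.Fin using (Fin; zero; suc)
open import Data.Fin.Subset using (Subset; _∈_; _∉_; _⊆_; ∣_∣; _∩_; ∁)
open import Data.Vec using (lookup)
open import Data.List using (List; []; _∷_; length)
import Data.List.Membership.Propositional as LM
open import Data.List.Relation.Unary.All using (All)
open import Data.List.Relation.Unary.Unique.Propositional using (Unique)
open import Data.Product using (Σ; ∃; _×_; _,_; proj₁; proj₂)
open import Data.Integer using (+_)
open import Data.Rational using (ℚ) renaming (_*_ to _*ℚ_; _≤_ to _≤ℚ_; _/_ to _/ℚ_)
open import Relation.Binary.PropositionalEquality using (_≡_; _≢_)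
open import Relation.Nullary using (¬_)
open import Function using (_∘_)

record SimpleGraph (n : ℕ) : Set where
  field
    adj    : Fin n → Fin n → Bool
    sym    : ∀ u v → adj u v ≡ adj v u
    irrefl : ∀ u → adj u u ≡ false
open SimpleGraph public

ℕ→ℚ : ℕ → ℚ
ℕ→ℚ k = (+ k) /ℚ 1

count : ∀ {n} → (Fin n → Bool) → ℕ
count {zero}  f = 0
count {suc n} f = (if f zero then 1 else 0) + count (f ∘ suc)

sumF : ∀ {n} → (Fin n → ℕ) → ℕ
sumF {zero}  f = 0
sumF {suc n} f = f zero + sumF (f ∘ suc)

module _ {n : ℕ} (G : SimpleGraph n) where

  deg : Fin n → ℕ
  deg u = count (adj G u)

  -- K = H[S] is the induced subgraph on S.
  -- deg_K(u)
  degIn : Subset n → Fin n → ℕ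
  degIn S u = count (λ v → lookup S v ∧ adj G u v)

  cut : Subset n → Subset n → ℕ
  cut S X = sumF (λ u → if lookup X u
                         then count (λ v → lookup S v ∧ (not (lookup X v) ∧ adj G u v))
                         else 0)

  vol : Subset n → Subset n → ℕ
  vol S X = sumF (λ u → if lookup X u then degIn S u else 0)

  IsExpander : Subset n → ℚ → Set
  IsExpander S φ = ∀ (X : Subset n) → X ⊆ S → 1 ≤ ∣ X ∣ → ∣ X ∣ < ∣ S ∣ →
    φ *ℚ ℕ→ℚ (vol S X ⊓ vol S (S ∩ ∁ X)) ≤ℚ ℕ→ℚ (cut S X)

  IsEdgeConnected : Subset n → ℚ → Set
  IsEdgeConnected S k = ∀ (X : Subset n) → X ⊆ S → 1 ≤ ∣ X ∣ → ∣ X ∣ < ∣ S ∣ →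
    k ≤ℚ ℕ→ℚ (cut S X)

  data Walk : Fin n → Fin n → Set where
    done : ∀ {u} → Walk u u
    step : ∀ {u v w} → T (adj G u v) → Walk v w → Walk u w

  wlength : ∀ {u v} → Walk u v → ℕ
  wlength done       = 0
  wlength (step _ w) = suc (wlength w)

  vertices : ∀ {u v} → Walk u v → List (Fin n)
  vertices {u} done       = u ∷ []
  vertices {u} (step _ w) = u ∷ vertices w

  edges : ∀ {u v} → Walk u v → List (Fin n × Fin n)
  edges done = []
  edges {u} (step {v = v} _ w) = (u , v) ∷ edges w

  IsPath : ∀ {u v} → Walk u v → Set
  IsPath w = Unique (vertices w)

  WalkIn : Subset n → ∀ {u v} → Walk u v → Set
  WalkIn S w = All (_∈ S) (vertices w)

  EdgeDisjoint : ∀ {u v u' v'} → Walk u v → Walk u' v' → Set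
  EdgeDisjoint w w' = ∀ a b → (a , b) LM.∈ edges w →
    ¬ ((a , b) LM.∈ edges w') × ¬ ((b , a) LM.∈ edges w')

at : ∀ {A : Set} (xs : List A) → Fin (length xs) → A
at (x ∷ xs) zero    = x
at (x ∷ xs) (suc i) = at xs i

PairwiseDisjoint : ∀ {n} → List (Subset n) → Set
PairwiseDisjoint F = ∀ i j → i ≢ j → ∀ v → v ∈ at F i → v ∉ at F j

InUnion : ∀ {n} → List (Subset n) → Fin n → Set
InUnion F v = ∃ λ i → v ∈ at F i

{-# OPTIONS --safe #-}
module Submission where

-- Put k = ⌈log₂ n⌉ and call S dense if 12 k vol(S) ≥ h |S| (1 + ⌈log₂ |S|⌉), where vol(S) is the degree
-- sum of H[S].  If a smallest dense set is split into X and Y with |X| ≤ |Y|, then neither part is dense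
-- and the logarithm of |X| is smaller by one, which forces h |X| ≤ 24 k e(X,Y); moreover vol(X) ≤ h |X| / 6.
-- Hence a smallest dense set induces a 1/(8k)-expander with all the properties in (1), the diameter bound
-- coming from the growth of volumes of balls.  Such sets are removed greedily until a remainder W
-- without dense subsets is left, so that 6 vol(X) ≤ h |X| for every X ⊆ W.
--
-- Discard from W the vertices with at most h/3 neighbours in W and repeat.  Each round at least halves W,
-- so there are O(log n) rounds, and a vertex discarded in a round has at least 2h/3 neighbours of lower
-- rank, that is, discarded in an earlier round or lying in a core.  The i-th path
-- from u follows at every vertex the i-th edge to a neighbour of lower rank; distinct indices never
-- share an edge.

open import Defs hiding (sym)
open import Data.Bool using (Bool; true; false; _∧_; _∨_; not; if_then_else_; T; T?)
open import Data.Bool.Properties using (∨-zeroʳ)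
open import Data.Fin using (Fin; zero; suc; toℕ)
open import Data.Fin.Properties using (any?; toℕ<n; toℕ-injective)
open import Data.Fin.Subset using (Subset; _∈_; _∉_; _⊆_; ∣_∣; _∩_; ∁; ⁅_⁆; ⊤; ⊥)
open import Data.Fin.Subset.Properties
  using (anySubset?; _∈?_; _⊆?_; nonempty?; Empty-unique; ∣⊥∣≡0; ∣⁅x⁆∣≡1; ∣⊤∣≡n; ∣p∣≤n; p⊆q⇒∣p∣≤∣q∣;
         ∈⊤; x∈⁅y⁆⇒x≡y; x∈p∩q⁺; x∈p∩q⁻; x∉p⇒x∈∁p; x∈∁p⇒x∉p)
import Data.Integer as ℤ
import Data.Integer.Properties as ℤ
open import Data.List using (List; []; _∷_; length; tabulate)
import Data.List.Membership.Propositional as LM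
open import Data.List.Properties using (length-tabulate)
open import Data.List.Relation.Unary.All as All using (All; []; _∷_)
import Data.List.Relation.Unary.All.Properties as All
open import Data.List.Relation.Unary.AllPairs using (AllPairs; []; _∷_)
import Data.List.Relation.Unary.AllPairs.Properties as AllPairs
open import Data.List.Relation.Unary.Any using (Any; here; there)
open import Data.Nat
open import Data.Nat.Induction using (<-rec)
open import Data.Nat.Logarithm using (⌈log₂_⌉; ⌈log₂⌉-mono-≤; ⌈log₂⌈n/2⌉⌉≡⌈log₂n⌉∸1; ⌈log₂2*n⌉≡1+⌈log₂n⌉)
open import Data.Nat.Properties
open import Algebra.Properties.CommutativeMonoid.Sum +-0-commutativeMonoid
  using (sum; sum-cong-≗; ∑-distrib-+; ∑-comm; sum-replicate-zero)
open import Algebra.Properties.Semiring.Sum +-*-semiring using (*-distribˡ-sum; *-distribʳ-sum)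
open import Data.Nat.Tactic.RingSolver using (solve-∀)
open import Data.Product using (Σ; ∃; _×_; _,_; proj₁; proj₂)
open import Data.Rational using (ℚ; 1ℚ; toℚᵘ) renaming (_*_ to _*ℚ_; _≤_ to _≤ℚ_; _/_ to _/ℚ_)
open import Data.Rational.Properties using (toℚᵘ-cancel-≤; toℚᵘ-homo-*; toℚᵘ-fromℚᵘ)
open import Data.Rational.Unnormalised using (mkℚᵘ; *≤*) renaming (_*_ to _*ᵘ_; _≤_ to _≤ᵘ_; _≃_ to _≃ᵘ_)
import Data.Rational.Unnormalised.Properties as ℚᵘ
open import Data.Sum using (_⊎_; inj₁; inj₂)
open import Data.Vec as Vec using (lookup; []; _∷_)
open import Data.Vec.Properties using ([]=⇒lookup; lookup⇒[]=; lookup-zipWith; lookup-map; lookup-replicate; lookup∘tabulate)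
open import Function using (_∘_)
open import Relation.Binary.PropositionalEquality hiding ([_])
open import Relation.Nullary using (¬_; Dec; yes; no; contradiction)
open import Relation.Nullary.Decidable using (⌊_⌋; _×-dec_; fromWitness; toWitness)
open import Relation.Unary using (Decidable)

-- Binary logarithms.

n≤2^⌈log₂n⌉ : ∀ n → n ≤ 2 ^ ⌈log₂ n ⌉
n≤2^⌈log₂n⌉ = <-rec _ go
  where
  go : ∀ n → (∀ {m} → m < n → m ≤ 2 ^ ⌈log₂ m ⌉) → n ≤ 2 ^ ⌈log₂ n ⌉
  go zero          rec = z≤n
  go (suc zero)    rec = ≤-refl
  go n@(suc (suc m)) rec = begin
    n                               ≡⟨ ⌊n/2⌋+⌈n/2⌉≡n n ⟨
    ⌊ n /2⌋ + ⌈ n /2⌉               ≤⟨ +-monoˡ-≤ ⌈ n /2⌉ (⌊n/2⌋≤⌈n/2⌉ n) ⟩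
    ⌈ n /2⌉ + ⌈ n /2⌉               ≤⟨ +-mono-≤ half half ⟩
    2 ^ (⌈log₂ n ⌉ ∸ 1) + 2 ^ (⌈log₂ n ⌉ ∸ 1)
      ≡⟨ cong (2 ^ (⌈log₂ n ⌉ ∸ 1) +_) (+-identityʳ _) ⟨
    2 ^ suc (⌈log₂ n ⌉ ∸ 1)         ≡⟨ cong (2 ^_) (m+[n∸m]≡n (⌈log₂⌉-mono-≤ {2} {n} (s≤s (s≤s z≤n)))) ⟩
    2 ^ ⌈log₂ n ⌉                   ∎
    where
    open ≤-Reasoning
    half : ⌈ n /2⌉ ≤ 2 ^ (⌈log₂ n ⌉ ∸ 1)
    half = subst (λ e → ⌈ n /2⌉ ≤ 2 ^ e) (⌈log₂⌈n/2⌉⌉≡⌈log₂n⌉∸1 n) (rec (⌈n/2⌉<n m))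

-- Holds because `2 * a ≤ a + b`. The unit gained here is what later pays for the edges between the
-- two parts of a dense set.
⌈log₂⌉-double : ∀ {a b} → 1 ≤ a → a ≤ b → suc ⌈log₂ a ⌉ ≤ ⌈log₂ a + b ⌉
⌈log₂⌉-double {a@(suc _)} {b} _ a≤b = subst (_≤ ⌈log₂ a + b ⌉) (⌈log₂2*n⌉≡1+⌈log₂n⌉ a)
  (⌈log₂⌉-mono-≤ (+-monoʳ-≤ a (subst (_≤ b) (sym (+-identityʳ a)) a≤b)))

-- Sums, indicator functions and partitions of vertex sets.

sum-mono : ∀ {n} {f g : Fin n → ℕ} → (∀ i → f i ≤ g i) → sum f ≤ sum g
sum-mono {zero}  f≤g = z≤n
sum-mono {suc n} f≤g = +-mono-≤ (f≤g zero) (sum-mono (f≤g ∘ suc))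

sumF≡sum : ∀ {n} (f : Fin n → ℕ) → sumF f ≡ sum f
sumF≡sum {zero}  f = refl
sumF≡sum {suc n} f = cong (f zero +_) (sumF≡sum (f ∘ suc))

ι : Bool → ℕ
ι b = if b then 1 else 0

χ : ∀ {n} → Subset n → Fin n → ℕ
χ S v = ι (lookup S v)

ι≤1 : ∀ b → ι b ≤ 1
ι≤1 true  = ≤-refl
ι≤1 false = z≤n

ι-∧ : ∀ a b → ι (a ∧ b) ≡ ι a * ι b
ι-∧ true  b = sym (+-identityʳ (ι b))
ι-∧ false b = refl

if-ι : ∀ b m → (if b then m else 0) ≡ ι b * m
if-ι true  m = sym (+-identityʳ m)
if-ι false m = refl

count≡sum : ∀ {n} (f : Fin n → Bool) → count f ≡ sum (ι ∘ f)
count≡sum {zero}  f = refl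
count≡sum {suc n} f = cong (ι (f zero) +_) (count≡sum (f ∘ suc))

count-mono : ∀ {n} {f g : Fin n → Bool} → (∀ v → f v ≡ true → g v ≡ true) → count f ≤ count g
count-mono {zero} f⊆g = z≤n
count-mono {suc n} {f} {g} f⊆g = +-mono-≤ (head (f zero) (g zero) (f⊆g zero)) (count-mono (f⊆g ∘ suc))
  where
  head : ∀ a b → (a ≡ true → b ≡ true) → ι a ≤ ι b
  head false b     _ = z≤n
  head true  true  _ = ≤-refl
  head true  false p with () ← p refl

∣S∣≡sum : ∀ {n} (S : Subset n) → ∣ S ∣ ≡ sum (χ S)
∣S∣≡sum []          = refl
∣S∣≡sum (true  ∷ S) = cong suc (∣S∣≡sum S)
∣S∣≡sum (false ∷ S) = ∣S∣≡sum S

sum-⁅⁆ : ∀ {n} (u : Fin n) (f : Fin n → ℕ) → sum (λ v → χ ⁅ u ⁆ v * f v) ≡ f u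
sum-⁅⁆ {suc n} zero f = begin
  1 * f zero + sum (λ v → χ ⊥ v * f (suc v))
    ≡⟨ cong₂ _+_ (*-identityˡ (f zero))
         (trans (sum-cong-≗ λ v → cong (λ b → ι b * f (suc v)) (lookup-replicate v false)) (sum-replicate-zero n)) ⟩
  f zero + 0 ≡⟨ +-identityʳ (f zero) ⟩
  f zero ∎
  where open ≡-Reasoning
sum-⁅⁆ (suc u) f = sum-⁅⁆ u (f ∘ suc)

infixl 6 _∖_
_∖_ : ∀ {n} → Subset n → Subset n → Subset n
S ∖ X = S ∩ ∁ X

lookup-∖ : ∀ {n} (S X : Subset n) v → lookup (S ∖ X) v ≡ lookup S v ∧ not (lookup X v)
lookup-∖ S X v = trans (lookup-zipWith _∧_ v S (∁ X)) (cong (lookup S v ∧_) (lookup-map v not X))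

-- One pointwise equation of indicators expresses both disjointness and covering, and it lets every
-- sum over `S` split by linearity.
Partition : ∀ {n} → Subset n → Subset n → Subset n → Set
Partition S X Y = ∀ v → χ S v ≡ χ X v + χ Y v

partition-comm : ∀ {n} {S X Y : Subset n} → Partition S X Y → Partition S Y X
partition-comm {X = X} {Y} p v = trans (p v) (+-comm (χ X v) (χ Y v))

⊆⇒partition : ∀ {n} {S X : Subset n} → X ⊆ S → Partition S X (S ∖ X)
⊆⇒partition {S = S} {X} X⊆S v rewrite lookup-∖ S X v with lookup X v in eq
... | false with lookup S v
...   | true  = refl
...   | false = refl
⊆⇒partition {S = S} {X} X⊆S v | true rewrite []=⇒lookup (X⊆S (lookup⇒[]= v X eq)) = refl

∣partition∣ : ∀ {n} {S X Y : Subset n} → Partition S X Y → ∣ S ∣ ≡ ∣ X ∣ + ∣ Y ∣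
∣partition∣ {S = S} {X} {Y} p = begin
  ∣ S ∣                     ≡⟨ ∣S∣≡sum S ⟩
  sum (χ S)                 ≡⟨ sum-cong-≗ p ⟩
  sum (λ v → χ X v + χ Y v) ≡⟨ ∑-distrib-+ (χ X) (χ Y) ⟩
  sum (χ X) + sum (χ Y)     ≡⟨ cong₂ _+_ (∣S∣≡sum X) (∣S∣≡sum Y) ⟨
  ∣ X ∣ + ∣ Y ∣             ∎
  where open ≡-Reasoning

⊆-χ : ∀ {n} {X Y : Subset n} → X ⊆ Y → ∀ v → χ X v ≤ χ Y v
⊆-χ {X = X} {Y} X⊆Y v = ≤-trans (m≤m+n (χ X v) (χ (Y ∖ X) v)) (≤-reflexive (sym (⊆⇒partition {S = Y} {X} X⊆Y v)))

∈∖⇒∈ : ∀ {n} {S X : Subset n} {v} → v ∈ S ∖ X → v ∈ S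
∈∖⇒∈ {S = S} {X} = proj₁ ∘ x∈p∩q⁻ S (∁ X)

partition⇒⊆ : ∀ {n} {S X Y : Subset n} → Partition S X Y → X ⊆ S
partition⇒⊆ {S = S} {X} p {v} v∈X with lookup S v in eq | p v
... | true  | _ = lookup⇒[]= v S eq
... | false | q rewrite []=⇒lookup v∈X with () ← q

-- Descent on cardinality: as long as some smaller subset satisfies `P`, which is decidable by
-- finite search, pass to it.
smallest : ∀ {n} {P : Subset n → Set} → Decidable P → ∀ S → P S →
  ∃ λ M → P M × (∀ X → ∣ X ∣ < ∣ M ∣ → ¬ P X)
smallest {n} {P} P? S = <-rec Q go ∣ S ∣ S refl
  where
  Q : ℕ → Set
  Q m = ∀ S → ∣ S ∣ ≡ m → P S → ∃ λ M → P M × (∀ X → ∣ X ∣ < ∣ M ∣ → ¬ P X)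
  go : ∀ m → (∀ {j} → j < m → Q j) → Q m
  go m rec S refl pS with anySubset? (λ X → (∣ X ∣ <? ∣ S ∣) ×-dec P? X)
  ... | yes (X , X<S , pX) = rec X<S X refl pX
  ... | no none            = S , pS , λ X X<S pX → none (X , X<S , pX)

-- Volumes and cuts as bilinear sums over adjacent pairs.

module Volume {n : ℕ} (G : SimpleGraph n) where

  -- Ordered pairs (u , v) of adjacent vertices, weighted by f u * g v.
  pairs : (Fin n → ℕ) → (Fin n → ℕ) → ℕ
  pairs f g = sum λ u → sum λ v → f u * (g v * ι (adj G u v))

  pairs-mono : ∀ f g f′ g′ →
    (∀ u v → f u * (g v * ι (adj G u v)) ≤ f′ u * (g′ v * ι (adj G u v))) → pairs f g ≤ pairs f′ g′
  pairs-mono f g f′ g′ le = sum-mono λ u → sum-mono (le u)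

  pairs-monoʳ : ∀ f {g g′} → (∀ v → g v ≤ g′ v) → pairs f g ≤ pairs f g′
  pairs-monoʳ f {g} {g′} le = pairs-mono f g f g′ λ u v → *-monoʳ-≤ (f u) (*-monoˡ-≤ (ι (adj G u v)) (le v))

  pairs-comm : ∀ f g → pairs f g ≡ pairs g f
  pairs-comm f g = trans (∑-comm (λ u v → f u * (g v * ι (adj G u v))))
    (sum-cong-≗ λ v → sum-cong-≗ λ u →
      trans (swap (f u) (g v) (ι (adj G u v))) (cong (λ b → g v * (f u * ι b)) (SimpleGraph.sym G u v)))
    where
    swap : ∀ a b c → a * (b * c) ≡ b * (a * c)
    swap = solve-∀

  pairs-+ʳ : ∀ f g a b → (∀ v → g v ≡ a v + b v) → pairs f g ≡ pairs f a + pairs f b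
  pairs-+ʳ f g a b eq = trans
    (sum-cong-≗ λ u → trans (sum-cong-≗ λ v →
        trans (cong (λ x → f u * (x * ι (adj G u v))) (eq v)) (dist (f u) (a v) (b v) (ι (adj G u v))))
      (∑-distrib-+ (λ v → f u * (a v * ι (adj G u v))) (λ v → f u * (b v * ι (adj G u v)))))
    (∑-distrib-+ (λ u → sum λ v → f u * (a v * ι (adj G u v))) (λ u → sum λ v → f u * (b v * ι (adj G u v))))
    where
    dist : ∀ f a b c → f * ((a + b) * c) ≡ f * (a * c) + f * (b * c)
    dist = solve-∀

  pairs-+ˡ : ∀ f g a b → (∀ v → f v ≡ a v + b v) → pairs f g ≡ pairs a g + pairs b g
  pairs-+ˡ f g a b eq = trans (pairs-comm f g)
    (trans (pairs-+ʳ g f a b eq) (cong₂ _+_ (pairs-comm g a) (pairs-comm g b)))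

  vol≡pairs : ∀ S X → vol G S X ≡ pairs (χ X) (χ S)
  vol≡pairs S X = trans (sumF≡sum {n} _) (sum-cong-≗ λ u → row u)
    where
    row : ∀ u → (if lookup X u then degIn G S u else 0) ≡ sum (λ v → χ X u * (χ S v * ι (adj G u v)))
    row u = trans (if-ι (lookup X u) _) (trans
      (cong (χ X u *_) (trans (count≡sum {n} _) (sum-cong-≗ λ v → ι-∧ (lookup S v) (adj G u v))))
      (*-distribˡ-sum (χ X u) (λ v → χ S v * ι (adj G u v))))

  cut≡pairs : ∀ S X → cut G S X ≡ pairs (χ X) (χ (S ∖ X))
  cut≡pairs S X = trans (sumF≡sum {n} _) (sum-cong-≗ λ u → row u)
    where
    entry : ∀ u v → ι (lookup S v ∧ (not (lookup X v) ∧ adj G u v)) ≡ χ (S ∖ X) v * ι (adj G u v)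
    entry u v rewrite lookup-∖ S X v with lookup S v
    ... | false = refl
    ... | true  = ι-∧ (not (lookup X v)) (adj G u v)
    row : ∀ u → (if lookup X u then count (λ v → lookup S v ∧ (not (lookup X v) ∧ adj G u v)) else 0)
          ≡ sum (λ v → χ X u * (χ (S ∖ X) v * ι (adj G u v)))
    row u = trans (if-ι (lookup X u) _) (trans
      (cong (χ X u *_) (trans (count≡sum {n} _) (sum-cong-≗ λ v → entry u v)))
      (*-distribˡ-sum (χ X u) (λ v → χ (S ∖ X) v * ι (adj G u v))))

  vol-⁅⁆ : ∀ S u → vol G S ⁅ u ⁆ ≡ degIn G S u
  vol-⁅⁆ S u = trans (sumF≡sum {n} _)
    (trans (sum-cong-≗ λ v → if-ι (lookup ⁅ u ⁆ v) (degIn G S v)) (sum-⁅⁆ u (degIn G S)))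

  degIn≤∣∣ : ∀ S u → degIn G S u ≤ ∣ S ∣
  degIn≤∣∣ S u = subst₂ _≤_ (sym (count≡sum {n} _)) (sym (∣S∣≡sum S)) (sum-mono λ v →
    subst (_≤ χ S v) (sym (ι-∧ (lookup S v) (adj G u v)))
      (subst (χ S v * ι (adj G u v) ≤_) (*-identityʳ (χ S v)) (*-monoʳ-≤ (χ S v) (ι≤1 (adj G u v)))))

  vol≤∣∣*∣∣ : ∀ S X → vol G S X ≤ ∣ X ∣ * ∣ S ∣
  vol≤∣∣*∣∣ S X = begin
    vol G S X                      ≡⟨ trans (sumF≡sum {n} _) (sum-cong-≗ λ u → if-ι (lookup X u) (degIn G S u)) ⟩
    sum (λ u → χ X u * degIn G S u) ≤⟨ sum-mono (λ u → *-monoʳ-≤ (χ X u) (degIn≤∣∣ S u)) ⟩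
    sum (λ u → χ X u * ∣ S ∣)      ≡⟨ *-distribʳ-sum ∣ S ∣ (χ X) ⟨
    sum (χ X) * ∣ S ∣              ≡⟨ cong (_* ∣ S ∣) (∣S∣≡sum X) ⟨
    ∣ X ∣ * ∣ S ∣                  ∎
    where open ≤-Reasoning

  module _ (S X Y : Subset n) (p : Partition S X Y) where

    vol-split : pairs (χ X) (χ S) ≡ pairs (χ X) (χ X) + pairs (χ X) (χ Y)
    vol-split = pairs-+ʳ (χ X) (χ S) (χ X) (χ Y) p

    vol-partition : pairs (χ S) (χ S) ≡ pairs (χ X) (χ S) + pairs (χ Y) (χ S)
    vol-partition = pairs-+ˡ (χ S) (χ S) (χ X) (χ Y) p

-- Expansion, cuts and degrees in smallest dense sets.

larger-positive : ∀ {a b} → a ≤ b → 1 ≤ a + b → 1 ≤ b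
larger-positive {b = suc b} _   _ = s≤s z≤n
larger-positive {b = zero}  z≤n ()

-- Here `x` and `y` are the sizes of the parts, `lx`, `ly`, `ls` the logarithmic factors, and `exx`,
-- `exy`, `eyy` the ordered adjacent pairs within and across. Subtracting the sparsity of both parts
-- from the density of the whole leaves `h * x`, the unit between `lx` and `ls`, against the cross
-- pairs, which the volume counts in both directions.
sparse-cut-arith : ∀ {h K x y lx ly ls exx exy eyy} →
  h * ((x + y) * ls) ≤ K * ((exx + exy) + (exy + eyy)) →
  K * exx ≤ h * (x * lx) → K * eyy ≤ h * (y * ly) → suc lx ≤ ls → ly ≤ ls →
  h * x ≤ 2 * K * exy
sparse-cut-arith {h} {K} {x} {y} {lx} {ly} {ls} {exx} {exy} {eyy} dense sx sy lx<ls ly≤ls =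
  +-cancelˡ-≤ (h * (x * lx) + h * (y * ls)) _ _ (begin
    h * (x * lx) + h * (y * ls) + h * x         ≡⟨ e₁ h x y lx ls ⟩
    h * (x * suc lx) + h * (y * ls)             ≤⟨ +-monoˡ-≤ _ (*-monoʳ-≤ h (*-monoʳ-≤ x lx<ls)) ⟩
    h * (x * ls) + h * (y * ls)                 ≡⟨ e₂ h x y ls ⟩
    h * ((x + y) * ls)                          ≤⟨ dense ⟩
    K * ((exx + exy) + (exy + eyy))             ≡⟨ e₃ K exx exy eyy ⟩
    K * exx + K * eyy + 2 * K * exy             ≤⟨ +-monoˡ-≤ _ (+-mono-≤ sx (≤-trans sy (*-monoʳ-≤ h (*-monoʳ-≤ y ly≤ls)))) ⟩
    h * (x * lx) + h * (y * ls) + 2 * K * exy   ∎)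
  where
  open ≤-Reasoning
  e₁ : ∀ h x y lx ls → h * (x * lx) + h * (y * ls) + h * x ≡ h * (x * suc lx) + h * (y * ls)
  e₁ = solve-∀
  e₂ : ∀ h x y ls → h * (x * ls) + h * (y * ls) ≡ h * ((x + y) * ls)
  e₂ = solve-∀
  e₃ : ∀ K a b c → K * ((a + b) + (b + c)) ≡ K * a + K * c + 2 * K * b
  e₃ = solve-∀

module Cores {n : ℕ} (G : SimpleGraph n) (h k : ℕ) (1≤h : 1 ≤ h) (1≤k : 1 ≤ k) (log≤k : ⌈log₂ n ⌉ ≤ k) where
  open Volume G

  -- The logarithm drops by one on the smaller side X of a cut, so if neither side is dense then the
  -- cut edges make up for the missing h * ∣ X ∣.
  weight : Subset n → ℕ
  weight S = h * (∣ S ∣ * suc ⌈log₂ ∣ S ∣ ⌉)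

  -- The empty set has weight 0 and would satisfy the inequality trivially, so it is excluded
  -- explicitly.
  Dense : Subset n → Set
  Dense S = 1 ≤ ∣ S ∣ × weight S ≤ 12 * k * vol G S S

  dense? : Decidable Dense
  dense? S = (1 ≤? ∣ S ∣) ×-dec (weight S ≤? 12 * k * vol G S S)

  Sparse : Subset n → Set
  Sparse X = 12 * k * pairs (χ X) (χ X) ≤ weight X

  ¬dense⇒sparse : ∀ {X} → ¬ Dense X → Sparse X
  ¬dense⇒sparse {X} ¬d with 1 ≤? ∣ X ∣
  ... | yes 1≤X = subst (λ e → 12 * k * e ≤ weight X) (vol≡pairs X X) (<⇒≤ (≰⇒> (λ le → ¬d (1≤X , le))))
  ... | no  ¬1≤X = ≤-trans (≤-reflexive (trans (cong (12 * k *_) e≡0) (*-zeroʳ (12 * k)))) z≤n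
    where
    e≡0 : pairs (χ X) (χ X) ≡ 0
    e≡0 = trans (sym (vol≡pairs X X)) (n≤0⇒n≡0
      (≤-trans (vol≤∣∣*∣∣ X X) (≤-reflexive (cong (_* ∣ X ∣) (n<1⇒n≡0 (≰⇒> ¬1≤X))))))

  -- The factor `suc ⌈log₂ ∣ X ∣ ⌉` is at most `1 + k`, hence at most `k + k`; dividing `12 * k` by
  -- `2 * k` leaves 6.
  sparse⇒low : ∀ {X} → Sparse X → 6 * pairs (χ X) (χ X) ≤ h * ∣ X ∣
  sparse⇒low {X} sp = *-cancelˡ-≤ (2 * k) {{>-nonZero (≤-trans 1≤k (m≤m+n k _))}} (begin
    2 * k * (6 * e)        ≡⟨ e₁ k e ⟩
    12 * k * e             ≤⟨ sp ⟩
    h * (∣ X ∣ * suc ⌈log₂ ∣ X ∣ ⌉)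
      ≤⟨ *-monoʳ-≤ h (*-monoʳ-≤ ∣ X ∣ (+-mono-≤ 1≤k (≤-trans (⌈log₂⌉-mono-≤ (∣p∣≤n X)) log≤k))) ⟩
    h * (∣ X ∣ * (k + k))  ≡⟨ e₂ h ∣ X ∣ k ⟩
    2 * k * (h * ∣ X ∣)    ∎)
    where
    open ≤-Reasoning
    e = pairs (χ X) (χ X)
    e₁ : ∀ k e → 2 * k * (6 * e) ≡ 12 * k * e
    e₁ = solve-∀
    e₂ : ∀ h x k → h * (x * (k + k)) ≡ 2 * k * (h * x)
    e₂ = solve-∀

  record Core (S : Subset n) : Set where
    field
      dense  : Dense S
      sparse : ∀ {X} → X ⊆ S → ∣ X ∣ < ∣ S ∣ → Sparse X

  module _ {S} (core : Core S) where
    open Core core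

    -- The density of `S` with its volume expanded over the parts; symmetry of adjacency makes both
    -- cross terms equal.
    dense-split : ∀ {X Y} → Partition S X Y →
      h * ((∣ X ∣ + ∣ Y ∣) * suc ⌈log₂ ∣ S ∣ ⌉) ≤
      12 * k * ((pairs (χ X) (χ X) + pairs (χ X) (χ Y)) + (pairs (χ X) (χ Y) + pairs (χ Y) (χ Y)))
    dense-split {X} {Y} p = subst₂ (λ s v → h * (s * suc ⌈log₂ ∣ S ∣ ⌉) ≤ 12 * k * v)
      (∣partition∣ {S = S} {X} {Y} p)
      (trans (vol≡pairs S S) (trans (vol-partition S X Y p)
        (cong₂ _+_ (vol-split S X Y p)
          (trans (vol-split S Y X q) (trans (+-comm (pairs (χ Y) (χ Y)) _)
            (cong (_+ pairs (χ Y) (χ Y)) (pairs-comm (χ Y) (χ X))))))))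
      (proj₂ dense)
      where
      q = partition-comm {S = S} {X} {Y} p

    smaller-part : ∀ {X Y} → Partition S X Y → ∣ X ∣ ≤ ∣ Y ∣ →
      h * ∣ X ∣ ≤ 24 * k * pairs (χ X) (χ Y) × 6 * pairs (χ X) (χ X) ≤ h * ∣ X ∣
    smaller-part {X} {Y} p X≤Y = split , sparse⇒low {X} sparseX
      where
      q = partition-comm {S = S} {X} {Y} p
      sizes = ∣partition∣ {S = S} {X} {Y} p
      -- `Y` is the larger part of a nonempty set, so `X` is strictly smaller than `S` and therefore
      -- sparse, even when `X` is empty.
      1≤Y : 1 ≤ ∣ Y ∣
      1≤Y = larger-positive X≤Y (subst (1 ≤_) sizes (proj₁ dense))
      sparseX : Sparse X
      sparseX = sparse (partition⇒⊆ {S = S} {X} {Y} p)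
        (subst (∣ X ∣ <_) (sym sizes) (m<m+n ∣ X ∣ 1≤Y))
      split : h * ∣ X ∣ ≤ 24 * k * pairs (χ X) (χ Y)
      split with 1 ≤? ∣ X ∣
      ... | no ¬1≤X = ≤-trans (≤-reflexive (trans (cong (h *_) (n<1⇒n≡0 (≰⇒> ¬1≤X))) (*-zeroʳ h))) z≤n
      ... | yes 1≤X = subst (λ c → h * ∣ X ∣ ≤ c * pairs (χ X) (χ Y)) (e k)
        (sparse-cut-arith {h} {12 * k} {∣ X ∣} {∣ Y ∣} (dense-split {X} {Y} p) sparseX sparseY
          (s≤s (subst (λ s → suc ⌈log₂ ∣ X ∣ ⌉ ≤ ⌈log₂ s ⌉) (sym sizes) (⌈log₂⌉-double 1≤X X≤Y)))
          (s≤s (⌈log₂⌉-mono-≤ (<⇒≤ Y<S))))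
        where
        Y<S : ∣ Y ∣ < ∣ S ∣
        Y<S = subst (∣ Y ∣ <_) (sym sizes) (m<n+m ∣ Y ∣ 1≤X)
        sparseY : Sparse Y
        sparseY = sparse (partition⇒⊆ {S = S} {Y} {X} q) Y<S
        e : ∀ k → 2 * (12 * k) ≡ 24 * k
        e = solve-∀

    -- Chaining `6 * pairs (χ X) (χ X) ≤ h * ∣ X ∣ ≤ 24 * k * δ` bounds the inner pairs by `4 * k *
    -- δ`. The cut itself adds at most `k * δ`, and the total `5 * k * δ` is rounded up to `8 * k *
    -- δ`.
    vol-smaller : ∀ {X Y} → Partition S X Y → ∣ X ∣ ≤ ∣ Y ∣ →
      pairs (χ X) (χ S) ≤ 8 * k * pairs (χ X) (χ Y)
    vol-smaller {X} {Y} p X≤Y = begin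
      pairs (χ X) (χ S)                     ≡⟨ vol-split S X Y p ⟩
      pairs (χ X) (χ X) + δ                 ≤⟨ +-mono-≤ inner (m≤m*n δ k {{>-nonZero 1≤k}}) ⟩
      4 * k * δ + δ * k                     ≤⟨ m≤m+n _ (3 * k * δ) ⟩
      4 * k * δ + δ * k + 3 * k * δ         ≡⟨ e₁ k δ ⟩
      8 * k * δ                             ∎
      where
      open ≤-Reasoning
      δ = pairs (χ X) (χ Y)
      e₁ : ∀ k d → 4 * k * d + d * k + 3 * k * d ≡ 8 * k * d
      e₁ = solve-∀
      e₂ : ∀ k d → 24 * k * d ≡ 6 * (4 * k * d)
      e₂ = solve-∀
      inner : pairs (χ X) (χ X) ≤ 4 * k * δ
      inner = *-cancelˡ-≤ 6 (≤-trans (proj₂ small) (≤-trans (proj₁ small) (≤-reflexive (e₂ k δ))))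
        where small = smaller-part {X} {Y} p X≤Y

    -- The part with fewer vertices need not have the smaller volume, but the minimum of the volumes
    -- is below either of them.
    expansion : ∀ {X Y} → Partition S X Y → vol G S X ⊓ vol G S Y ≤ 8 * k * pairs (χ X) (χ Y)
    expansion {X} {Y} p with ≤-total ∣ X ∣ ∣ Y ∣
    ... | inj₁ X≤Y = ≤-trans (m⊓n≤m (vol G S X) _) (subst (_≤ 8 * k * pairs (χ X) (χ Y))
                       (sym (vol≡pairs S X)) (vol-smaller {X} {Y} p X≤Y))
    ... | inj₂ Y≤X = ≤-trans (m⊓n≤n (vol G S X) _) (subst₂ (λ v c → v ≤ 8 * k * c)
                       (sym (vol≡pairs S Y)) (pairs-comm (χ Y) (χ X))
                       (vol-smaller {Y} {X} (partition-comm {S = S} {X} {Y} p) Y≤X))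

    core-expansion : ∀ {X} → X ⊆ S → vol G S X ⊓ vol G S (S ∖ X) ≤ 8 * k * cut G S X
    core-expansion {X} X⊆S = subst (λ c → vol G S X ⊓ vol G S (S ∖ X) ≤ 8 * k * c)
      (sym (cut≡pairs S X)) (expansion {X} {S ∖ X} (⊆⇒partition X⊆S))

    -- The smaller side has at least one vertex, so `h` is at most `h` times its size, which
    -- `smaller-part` bounds by the cut.
    core-cut : ∀ {X} → X ⊆ S → 1 ≤ ∣ X ∣ → ∣ X ∣ < ∣ S ∣ → h ≤ 24 * k * cut G S X
    core-cut {X} X⊆S 1≤X X<S = subst (λ c → h ≤ 24 * k * c) (sym (cut≡pairs S X)) bound
      where
      Y = S ∖ X
      p : Partition S X Y
      p = ⊆⇒partition X⊆S
      sizes = ∣partition∣ {S = S} {X} {Y} p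
      1≤Y : 1 ≤ ∣ Y ∣
      1≤Y = +-cancelˡ-≤ (∣ X ∣) 1 (∣ Y ∣) (subst₂ _≤_ (+-comm 1 ∣ X ∣) sizes X<S)
      bound : h ≤ 24 * k * pairs (χ X) (χ Y)
      bound with ≤-total ∣ X ∣ ∣ Y ∣
      ... | inj₁ X≤Y = ≤-trans (m≤m*n h ∣ X ∣ {{>-nonZero 1≤X}}) (proj₁ (smaller-part {X} {Y} p X≤Y))
      ... | inj₂ Y≤X = ≤-trans (m≤m*n h ∣ Y ∣ {{>-nonZero 1≤Y}})
            (subst (λ c → h * ∣ Y ∣ ≤ 24 * k * c) (pairs-comm (χ Y) (χ X))
              (proj₁ (smaller-part {Y} {X} (partition-comm {S = S} {X} {Y} p) Y≤X)))

    -- Removing `u` lowers the volume by at most twice its degree. Comparing the density of `S` with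
    -- the sparsity of what remains therefore bounds the degree from below; the case of `S`
    -- consisting of `u` alone is covered, unlike in `core-cut`.
    core-degree : ∀ {u} → u ∈ S → h ≤ 24 * k * degIn G S u
    core-degree {u} u∈S = +-cancelˡ-≤ (h * (y * ls)) _ _ (begin
      h * (y * ls) + h              ≤⟨ +-monoʳ-≤ (h * (y * ls)) (m≤m*n h ls) ⟩
      h * (y * ls) + h * ls         ≡⟨ e₁ h y ls ⟩
      h * ((1 + y) * ls)            ≡⟨ cong (λ x → h * ((x + y) * ls)) (∣⁅x⁆∣≡1 u) ⟨
      h * ((∣ X ∣ + y) * ls)        ≤⟨ dense-split {X} {Y} p ⟩
      12 * k * ((pairs (χ X) (χ X) + δ) + (δ + eyy))
        ≡⟨ cong (λ d → 12 * k * (d + (δ + eyy))) (trans (sym (vol-split S X Y p)) d≡) ⟩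
      12 * k * (d + (δ + eyy))      ≤⟨ *-monoʳ-≤ (12 * k) (+-monoʳ-≤ d (+-monoˡ-≤ eyy δ≤d)) ⟩
      12 * k * (d + (d + eyy))      ≡⟨ e₂ k d eyy ⟩
      12 * k * eyy + 24 * k * d     ≤⟨ +-monoˡ-≤ _ (sparse (partition⇒⊆ {S = S} {Y} {X} (partition-comm {S = S} {X} {Y} p)) Y<S) ⟩
      h * (y * suc ⌈log₂ y ⌉) + 24 * k * d
        ≤⟨ +-monoˡ-≤ _ (*-monoʳ-≤ h (*-monoʳ-≤ y (s≤s (⌈log₂⌉-mono-≤ (<⇒≤ Y<S))))) ⟩
      h * (y * ls) + 24 * k * d     ∎)
      where
      open ≤-Reasoning
      X = ⁅ u ⁆
      Y = S ∖ X
      p : Partition S X Y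
      p = ⊆⇒partition λ {v} v∈ → subst (_∈ S) (sym (x∈⁅y⁆⇒x≡y u v∈)) u∈S
      y = ∣ Y ∣
      ls = suc ⌈log₂ ∣ S ∣ ⌉
      δ = pairs (χ X) (χ Y)
      eyy = pairs (χ Y) (χ Y)
      d = degIn G S u
      d≡ : pairs (χ X) (χ S) ≡ d
      d≡ = trans (sym (vol≡pairs S X)) (vol-⁅⁆ S u)
      δ≤d : δ ≤ d
      δ≤d = subst (δ ≤_) (trans (sym (vol-split S X Y p)) d≡) (m≤n+m δ _)
      Y<S : y < ∣ S ∣
      Y<S = subst (y <_) (sym (∣partition∣ {S = S} {X} {Y} p)) (m<n+m y (≤-reflexive (sym (∣⁅x⁆∣≡1 u))))
      e₁ : ∀ h y l → h * (y * l) + h * l ≡ h * ((1 + y) * l)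
      e₁ = solve-∀
      e₂ : ∀ k d e → 12 * k * (d + (d + e)) ≡ 12 * k * e + 24 * k * d
      e₂ = solve-∀

    -- A degree inside `S` is at most the size of `S`. This limits how many disjoint cores can be
    -- removed.
    core-size : h ≤ 24 * k * ∣ S ∣
    core-size with nonempty? S
    ... | yes (u , u∈S) = ≤-trans (core-degree u∈S) (*-monoʳ-≤ (24 * k) (degIn≤∣∣ S u))
    ... | no  empty     = contradiction (proj₁ dense)
      (subst (λ m → ¬ 1 ≤ m) (sym (trans (cong ∣_∣ (Empty-unique empty)) (∣⊥∣≡0 n))) λ())

-- Growth of balls and the diameter of an expander.

-- A sequence gaining a fraction `1 / p` in each step doubles every `p` steps, until it exceeds
-- `V / 2`; by monotonicity it then stays above.
geometric-growth : ∀ (b : ℕ → ℕ) V p → .{{_ : NonZero p}} → 1 ≤ b 0 → (∀ m → b m ≤ b (suc m)) →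
  (∀ m → V < 2 * b m ⊎ b m + p * b m ≤ p * b (suc m)) →
  ∀ j → V < 2 * b (j * p) ⊎ 2 ^ j ≤ b (j * p)
geometric-growth b V p 1≤b₀ mono grow = doubling
  where
  later : ∀ m i → b m ≤ b (i + m)
  later m zero    = ≤-refl
  later m (suc i) = ≤-trans (later m i) (mono (i + m))

  -- Linear rather than compound growth suffices: each step raises `p * b` by at least `b m`, so `p`
  -- steps reach `2 * b m`.
  steps : ∀ m i → V < 2 * b (i + m) ⊎ (i + p) * b m ≤ p * b (i + m)
  steps m zero = inj₂ ≤-refl
  steps m (suc i) with steps m i
  ... | inj₁ big = inj₁ (≤-trans big (*-monoʳ-≤ 2 (mono (i + m))))
  ... | inj₂ le with grow (i + m)
  ...   | inj₁ big = inj₁ (≤-trans big (*-monoʳ-≤ 2 (mono (i + m))))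
  ...   | inj₂ gr  = inj₂ (≤-trans (+-mono-≤ (later m i) le) gr)

  doubling : ∀ j → V < 2 * b (j * p) ⊎ 2 ^ j ≤ b (j * p)
  doubling zero = inj₂ 1≤b₀
  doubling (suc j) with doubling j
  ... | inj₁ big = inj₁ (≤-trans big (*-monoʳ-≤ 2 (later (j * p) p)))
  ... | inj₂ le with steps (j * p) p
  ...   | inj₁ big = inj₁ big
  ...   | inj₂ gr  = inj₂ (≤-trans (*-monoʳ-≤ 2 le)
            (*-cancelˡ-≤ p (subst (_≤ p * b (p + j * p)) (e p (b (j * p))) gr)))
    where
    e : ∀ p b → (p + p) * b ≡ p * (2 * b)
    e = solve-∀

indicator-mono : ∀ a b c d → (a ≡ true → b ≡ true → c ≡ true → d ≡ true) →
  ι a * (ι b * ι c) ≤ ι a * (ι d * ι c)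
indicator-mono false b     c     d     _ = z≤n
indicator-mono true  false c     d     _ = z≤n
indicator-mono true  true  false d     _ rewrite *-zeroʳ (ι d) = z≤n
indicator-mono true  true  true  d     f rewrite f refl refl refl = ≤-refl

∧-true : ∀ {a b} → a ∧ b ≡ true → a ≡ true × b ≡ true
∧-true {true} {true} refl = refl , refl

∨-true : ∀ {a b} → a ∨ b ≡ true → a ≡ true ⊎ b ≡ true
∨-true {true}  _ = inj₁ refl
∨-true {false} e = inj₂ e

≡true⇒T : ∀ {b} → b ≡ true → T b
≡true⇒T refl = _

T⇒≡true : ∀ {b} → T b → b ≡ true
T⇒≡true {true} _ = refl

module Walks {n : ℕ} (G : SimpleGraph n) where

  ᵀsym : ∀ {u v} → T (adj G u v) → T (adj G v u)
  ᵀsym {u} {v} = subst T (SimpleGraph.sym G u v)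

  -- Reverses the first walk onto the second one.
  revAppend : ∀ {u v w} → Walk G w u → Walk G w v → Walk G u v
  revAppend done       q = q
  revAppend (step e p) q = revAppend p (step (ᵀsym e) q)

  revAppend-length : ∀ {u v w} (p : Walk G w u) (q : Walk G w v) →
    wlength G (revAppend p q) ≡ wlength G p + wlength G q
  revAppend-length done       q = refl
  revAppend-length (step e p) q = trans (revAppend-length p (step (ᵀsym e) q)) (+-suc (wlength G p) (wlength G q))

  start∈ : ∀ {S u v} (p : Walk G u v) → WalkIn G S p → u ∈ S
  start∈ done       (u∈ ∷ _) = u∈
  start∈ (step _ _) (u∈ ∷ _) = u∈

  revAppend-in : ∀ {S u v w} (p : Walk G w u) (q : Walk G w v) →
    WalkIn G S p → WalkIn G S q → WalkIn G S (revAppend p q)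
  revAppend-in done       q _         inq = inq
  revAppend-in (step e p) q (_ ∷ inp) inq = revAppend-in p _ inp (start∈ p inp ∷ inq)

module Diameter {n : ℕ} (G : SimpleGraph n) (S : Subset n) (p : ℕ) .{{_ : NonZero p}}
  (expands : ∀ {X} → X ⊆ S → vol G S X ⊓ vol G S (S ∖ X) ≤ p * cut G S X)
  (positive : ∀ {u} → u ∈ S → 1 ≤ degIn G S u) where
  open Volume G
  open Walks G

  touches? : ∀ B v → Dec (∃ λ w → w ∈ B × T (adj G v w))
  touches? B v = any? λ w → (w ∈? B) ×-dec T? (adj G v w)

  -- For `B ⊆ S` this is the closed neighbourhood of `B` in the subgraph induced by `S`.
  grow : Subset n → Subset n
  grow B = Vec.tabulate λ v → lookup S v ∧ (lookup B v ∨ ⌊ touches? B v ⌋)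

  lookup-grow : ∀ B v → lookup (grow B) v ≡ lookup S v ∧ (lookup B v ∨ ⌊ touches? B v ⌋)
  lookup-grow B v = lookup∘tabulate _ v

  grow⊆S : ∀ {B} → grow B ⊆ S
  grow⊆S {B} {v} v∈ = lookup⇒[]= v S (proj₁ (∧-true (trans (sym (lookup-grow B v)) ([]=⇒lookup v∈))))

  grow⁻ : ∀ {B v} → v ∈ grow B → v ∈ B ⊎ ∃ λ w → w ∈ B × T (adj G v w)
  grow⁻ {B} {v} v∈
    with ∨-true {lookup B v} (proj₂ (∧-true {lookup S v} (trans (sym (lookup-grow B v)) ([]=⇒lookup v∈))))
  ... | inj₁ e = inj₁ (lookup⇒[]= v B e)
  ... | inj₂ e = inj₂ (toWitness {a? = touches? B v} (≡true⇒T e))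

  grow⁺ : ∀ {B v} → v ∈ S → v ∈ B ⊎ (∃ λ w → w ∈ B × T (adj G v w)) → v ∈ grow B
  grow⁺ {B} {v} v∈S c = lookup⇒[]= v (grow B) (trans (lookup-grow B v)
    (cong₂ _∧_ ([]=⇒lookup v∈S) (inside c)))
    where
    inside : v ∈ B ⊎ (∃ λ w → w ∈ B × T (adj G v w)) → lookup B v ∨ ⌊ touches? B v ⌋ ≡ true
    inside (inj₁ v∈B) = cong (_∨ ⌊ touches? B v ⌋) ([]=⇒lookup v∈B)
    inside (inj₂ t) = trans (cong (lookup B v ∨_) (T⇒≡true (fromWitness {a? = touches? B v} t))) (∨-zeroʳ (lookup B v))

  B⊆grow : ∀ {B} → B ⊆ S → B ⊆ grow B
  B⊆grow {B} B⊆S v∈B = grow⁺ {B} (B⊆S v∈B) (inj₁ v∈B)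

  ∈∖⁺ : ∀ {X Y : Subset n} {v} → v ∈ X → v ∉ Y → v ∈ X ∖ Y
  ∈∖⁺ v∈X v∉Y = x∈p∩q⁺ (v∈X , x∉p⇒x∈∁p v∉Y)

  -- Every edge leaving `B` inside `S` ends at a newly reached vertex and is counted again, from
  -- that end, in the volume of the new vertices `D`.
  vol-grow : ∀ {B} → B ⊆ S → vol G S B + cut G S B ≤ vol G S (grow B)
  vol-grow {B} B⊆S = subst₂ _≤_
    (sym (cong₂ _+_ (vol≡pairs S B) (cut≡pairs S B)))
    (sym (trans (vol≡pairs S (grow B)) (pairs-+ˡ (χ (grow B)) (χ S) (χ B) (χ D) (⊆⇒partition (B⊆grow B⊆S)))))
    (+-monoʳ-≤ (pairs (χ B) (χ S)) (begin
      pairs (χ B) (χ (S ∖ B)) ≤⟨ pairs-mono (χ B) (χ (S ∖ B)) (χ B) (χ D) (λ u v →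
        indicator-mono (lookup B u) (lookup (S ∖ B) v) (adj G u v) (lookup D v) (boundary u v)) ⟩
      pairs (χ B) (χ D)       ≡⟨ pairs-comm (χ B) (χ D) ⟩
      pairs (χ D) (χ B)       ≤⟨ pairs-monoʳ (χ D) (⊆-χ B⊆S) ⟩
      pairs (χ D) (χ S)       ∎))
    where
    open ≤-Reasoning
    D = grow B ∖ B
    boundary : ∀ u v → lookup B u ≡ true → lookup (S ∖ B) v ≡ true → adj G u v ≡ true → lookup D v ≡ true
    boundary u v u∈ v∈ uv = []=⇒lookup (∈∖⁺ {grow B} {B}
        (grow⁺ {B} (proj₁ v∈′) (inj₂ (u , lookup⇒[]= u B u∈ , ᵀsym (≡true⇒T uv))))
        (x∈∁p⇒x∉p (proj₂ v∈′)))
      where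
      v∈′ : v ∈ S × v ∈ ∁ B
      v∈′ = x∈p∩q⁻ S (∁ B) (lookup⇒[]= v (S ∖ B) v∈)

  vol-complement : ∀ {X} → X ⊆ S → vol G S S ≡ vol G S X + vol G S (S ∖ X)
  vol-complement {X} X⊆S = trans (vol≡pairs S S) (trans (vol-partition S X (S ∖ X) (⊆⇒partition X⊆S))
    (sym (cong₂ _+_ (vol≡pairs S X) (vol≡pairs S (S ∖ X)))))

  vol-mono : ∀ {X Y} → X ⊆ Y → vol G S X ≤ vol G S Y
  vol-mono {X} {Y} X⊆Y = subst₂ _≤_
    (trans (pairs-comm (χ S) (χ X)) (sym (vol≡pairs S X))) (trans (pairs-comm (χ S) (χ Y)) (sym (vol≡pairs S Y)))
    (pairs-monoʳ (χ S) (⊆-χ X⊆Y))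

  -- While `B` has at most half the volume, the minimum in the expansion bound is its own volume, so
  -- the cut adds at least a fraction `1 / p`.
  growth : ∀ {B} → B ⊆ S → vol G S S < 2 * vol G S B ⊎ vol G S B + p * vol G S B ≤ p * vol G S (grow B)
  growth {B} B⊆S with 2 * vol G S B ≤? vol G S S
  ... | no  big   = inj₁ (≰⇒> big)
  ... | yes small = inj₂ (begin
    b + p * b             ≤⟨ +-monoˡ-≤ (p * b) (subst (_≤ p * cut G S B) (m≤n⇒m⊓n≡m b≤rest) (expands B⊆S)) ⟩
    p * cut G S B + p * b ≡⟨ +-comm (p * cut G S B) (p * b) ⟩
    p * b + p * cut G S B ≡⟨ *-distribˡ-+ p b (cut G S B) ⟨
    p * (b + cut G S B)   ≤⟨ *-monoʳ-≤ p (vol-grow B⊆S) ⟩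
    p * vol G S (grow B)  ∎)
    where
    open ≤-Reasoning
    b = vol G S B
    b≤rest : b ≤ vol G S (S ∖ B)
    b≤rest = subst (_≤ vol G S (S ∖ B)) (+-identityʳ b)
      (+-cancelˡ-≤ b _ _ (subst (2 * b ≤_) (vol-complement B⊆S) small))

  ball : Fin n → ℕ → Subset n
  ball u zero    = ⁅ u ⁆
  ball u (suc m) = grow (ball u m)

  ball⊆S : ∀ {u} → u ∈ S → ∀ m → ball u m ⊆ S
  ball⊆S {u} u∈S zero    v∈ = subst (_∈ S) (sym (x∈⁅y⁆⇒x≡y u v∈)) u∈S
  ball⊆S {u} u∈S (suc m)    = grow⊆S {ball u m}

  ball-walk : ∀ {u} → u ∈ S → ∀ m {v} → v ∈ ball u m →
    Σ (Walk G v u) λ w → WalkIn G S w × wlength G w ≤ m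
  ball-walk {u} u∈S zero v∈ with refl ← x∈⁅y⁆⇒x≡y u v∈ = done , u∈S ∷ [] , z≤n
  ball-walk {u} u∈S (suc m) {v} v∈ with grow⁻ {ball u m} v∈
  ... | inj₁ v∈B with w , inS , len ← ball-walk u∈S m v∈B = w , inS , m≤n⇒m≤1+n len
  ... | inj₂ (x , x∈B , e) with w , inS , len ← ball-walk u∈S m x∈B =
    step e w , grow⊆S {ball u m} v∈ ∷ inS , s≤s len

  -- If the ball has not passed half the volume on the way, its volume is at least `2 ^ j`, hence at
  -- least that of `S`. Being positive, it then has more than half after all.
  large-ball : ∀ {u} → u ∈ S → ∀ j → vol G S S ≤ 2 ^ j → vol G S S < 2 * vol G S (ball u (j * p))
  large-ball {u} u∈S j V≤ with geometric-growth (λ m → vol G S (ball u m)) (vol G S S) p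
      (subst (1 ≤_) (sym (vol-⁅⁆ S u)) (positive u∈S))
      (λ m → vol-mono (B⊆grow (ball⊆S u∈S m)))
      (λ m → growth (ball⊆S u∈S m)) j
  ... | inj₁ big = big
  ... | inj₂ le = ≤-<-trans (≤-trans V≤ le) (m<m+n b (≤-trans 1≤b (m≤m+n b 0)))
    where
    b = vol G S (ball u (j * p))
    1≤b : 1 ≤ b
    1≤b = ≤-trans (m^n>0 2 j) le

  -- Two balls that each hold more than half the volume cannot be disjoint; the walk passes through
  -- a common vertex.
  diameter : ∀ j → vol G S S ≤ 2 ^ j → ∀ {u v} → u ∈ S → v ∈ S →
    Σ (Walk G u v) λ w → WalkIn G S w × wlength G w ≤ j * p + j * p
  diameter j V≤ {u} {v} u∈S v∈S with any? (λ x → (x ∈? ball u (j * p)) ×-dec (x ∈? ball v (j * p)))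
  ... | yes (x , x∈u , x∈v)
    with P , inP , lenP ← ball-walk u∈S (j * p) x∈u
       | Q , inQ , lenQ ← ball-walk v∈S (j * p) x∈v =
    revAppend P Q , revAppend-in P Q inP inQ ,
    subst (_≤ j * p + j * p) (sym (revAppend-length P Q)) (+-mono-≤ lenP lenQ)
  ... | no disjoint = contradiction (begin-strict
    V + V                 <⟨ +-mono-< (large-ball u∈S j V≤) (large-ball v∈S j V≤) ⟩
    2 * bu + 2 * bv       ≡⟨ *-distribˡ-+ 2 bu bv ⟨
    2 * (bu + bv)         ≤⟨ *-monoʳ-≤ 2 (+-monoʳ-≤ bu (vol-mono {ball v (j * p)} {S ∖ ball u (j * p)} apart)) ⟩
    2 * (bu + vol G S (S ∖ ball u (j * p))) ≡⟨ cong (2 *_) (vol-complement (ball⊆S u∈S (j * p))) ⟨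
    2 * V                 ≡⟨ cong (V +_) (+-identityʳ V) ⟩
    V + V                 ∎) (<-irrefl refl)
    where
    open ≤-Reasoning
    V = vol G S S
    bu = vol G S (ball u (j * p))
    bv = vol G S (ball v (j * p))
    apart : ball v (j * p) ⊆ S ∖ ball u (j * p)
    apart {x} x∈v = ∈∖⁺ {S} {ball u (j * p)} (ball⊆S v∈S (j * p) x∈v) (λ x∈u → disjoint (x , x∈u , x∈v))

-- Positions in lists and numbering of the true values of a predicate.

Any⇒at : ∀ {A : Set} {P : A → Set} {xs} → Any P xs → ∃ λ i → P (at xs i)
Any⇒at (here p)  = zero , p
Any⇒at (there a) with i , p ← Any⇒at a = suc i , p

All⇒at : ∀ {A : Set} {P : A → Set} {xs} → All P xs → ∀ i → P (at xs i)
All⇒at (p ∷ ps) zero    = p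
All⇒at (p ∷ ps) (suc i) = All⇒at ps i

AllPairs⇒at : ∀ {A : Set} {R : A → A → Set} → (∀ x y → R x y → R y x) →
  ∀ {xs} → AllPairs R xs → ∀ i j → i ≢ j → R (at xs i) (at xs j)
AllPairs⇒at sy (r ∷ rs) zero    zero    i≢j = contradiction refl i≢j
AllPairs⇒at sy (r ∷ rs) zero    (suc j) i≢j = All⇒at r j
AllPairs⇒at sy (r ∷ rs) (suc i) zero    i≢j = sy _ _ (All⇒at r i)
AllPairs⇒at sy (r ∷ rs) (suc i) (suc j) i≢j = AllPairs⇒at sy rs i j (i≢j ∘ cong suc)

-- The number of indices before `v` at which `f` is true. It numbers the edges from a vertex to its
-- neighbours of lower rank, and `select` recovers such an index from its number.
position : ∀ {n} → (Fin n → Bool) → Fin n → ℕ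
position f zero    = 0
position f (suc v) = ι (f zero) + position (f ∘ suc) v

select : ∀ {n} (f : Fin n → Bool) i → i < count f → ∃ λ v → f v ≡ true × position f v ≡ i
select {suc n} f i i< with f zero in f₀
select {suc n} f zero    i< | true = zero , f₀ , refl
select {suc n} f (suc i) i< | true with v , fv , pos ← select (f ∘ suc) i (s≤s⁻¹ i<) =
  suc v , fv , trans (cong (λ b → ι b + position (f ∘ suc) v) f₀) (cong suc pos)
select {suc n} f i       i< | false with v , fv , pos ← select (f ∘ suc) i i< =
  suc v , fv , trans (cong (λ b → ι b + position (f ∘ suc) v) f₀) pos

-- Greedy removal of cores.

Disjoint : ∀ {n} → Subset n → Subset n → Set
Disjoint A B = ∀ v → v ∈ A → v ∉ B

module Decomposing {n : ℕ} (G : SimpleGraph n) (h k : ℕ) (1≤h : 1 ≤ h) (1≤k : 1 ≤ k) (log≤k : ⌈log₂ n ⌉ ≤ k) where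
  open Volume G
  open Cores G h k 1≤h 1≤k log≤k

  record Decomposition (U : Subset n) : Set where
    field
      cores    : List (Subset n)
      rest     : Subset n
      areCores : All Core cores
      within   : All (_⊆ U) cores
      disjoint : AllPairs Disjoint cores
      few      : length cores * h ≤ 24 * k * ∣ U ∣
      cover    : ∀ {v} → v ∈ U → v ∈ rest ⊎ Any (v ∈_) cores
      noDense  : ∀ {X} → X ⊆ rest → ¬ Dense X

  -- Being smallest among the dense subsets of the current `U` is enough, since the core condition
  -- concerns only subsets of `M`, and these lie in `U`.
  smallest⇒core : ∀ {U M} → M ⊆ U → Dense M → (∀ X → ∣ X ∣ < ∣ M ∣ → ¬ (X ⊆ U × Dense X)) → Core M
  smallest⇒core {U} {M} M⊆U dM least = record
    { dense  = dM
    ; sparse = λ {X} X⊆M X<M → ¬dense⇒sparse {X} λ dX → least X X<M ((λ {x} x∈ → M⊆U (X⊆M x∈)) , dX) }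

  decompose : ∀ U → Decomposition U
  decompose U = <-rec Q go ∣ U ∣ U refl
    where
    Q : ℕ → Set
    Q m = ∀ U → ∣ U ∣ ≡ m → Decomposition U
    go : ∀ m → (∀ {j} → j < m → Q j) → Q m
    go m rec U refl with anySubset? (λ X → (X ⊆? U) ×-dec dense? X)
    ... | no none = record
      { cores = [] ; rest = U ; areCores = [] ; within = [] ; disjoint = [] ; few = z≤n
      ; cover = inj₁ ; noDense = λ {X} X⊆U dX → none (X , X⊆U , dX) }
    ... | yes (X , pX) with smallest (λ X → (X ⊆? U) ×-dec dense? X) X pX
    ...   | M , (M⊆U , dM) , least = record
      { cores    = M ∷ cores
      ; rest     = rest
      ; areCores = core ∷ areCores
      ; within   = (λ {x} → M⊆U {x}) ∷ All.map (λ K⊆ {x} x∈K → ∈∖⇒∈ {S = U} {M} (K⊆ x∈K)) within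
      ; disjoint = All.map (λ K⊆ v v∈M v∈K →
                     x∈∁p⇒x∉p (proj₂ (x∈p∩q⁻ U (∁ M) (K⊆ v∈K))) v∈M) within ∷ disjoint
      ; few      = begin
          h + length cores * h               ≤⟨ +-mono-≤ (core-size core) few ⟩
          24 * k * ∣ M ∣ + 24 * k * ∣ U ∖ M ∣ ≡⟨ *-distribˡ-+ (24 * k) (∣ M ∣) (∣ U ∖ M ∣) ⟨
          24 * k * (∣ M ∣ + ∣ U ∖ M ∣)       ≡⟨ cong (24 * k *_) sizes ⟨
          24 * k * ∣ U ∣                     ∎
      ; cover    = covered
      ; noDense  = noDense
      }
      where
      open ≤-Reasoning
      core : Core M
      core = smallest⇒core M⊆U dM least
      sizes : ∣ U ∣ ≡ ∣ M ∣ + ∣ U ∖ M ∣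
      sizes = ∣partition∣ {S = U} {M} {U ∖ M} (⊆⇒partition M⊆U)
      remaining : Decomposition (U ∖ M)
      -- The recursion decreases because a dense set is nonempty by definition.
      remaining = rec (subst (∣ U ∖ M ∣ <_) (sym sizes) (m<n+m (∣ U ∖ M ∣) (proj₁ dM))) (U ∖ M) refl
      open Decomposition remaining
      covered : ∀ {v} → v ∈ U → v ∈ rest ⊎ Any (v ∈_) (M ∷ cores)
      covered {v} v∈U with v ∈? M
      ... | yes v∈M = inj₂ (here v∈M)
      ... | no  v∉M with cover (x∈p∩q⁺ (v∈U , x∉p⇒x∈∁p v∉M))
      ...   | inj₁ r = inj₁ r
      ...   | inj₂ a = inj₂ (there a)

-- Edge-disjoint paths along decreasing ranks.

module Descents {n : ℕ} (G : SimpleGraph n) where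

  lower : (Fin n → ℕ) → Fin n → Fin n → Bool
  lower r v w = adj G v w ∧ (r w <ᵇ r v)

  lower⁺ : ∀ r {v w} → adj G v w ≡ true → r w < r v → lower r v w ≡ true
  lower⁺ r vw lt = cong₂ _∧_ vw (T⇒≡true (<⇒<ᵇ lt))

  module _ (r : Fin n → ℕ) where

    -- A descent with index i leaves every vertex along its i-th edge to lower rank, so descents with
    -- different indices cannot share an edge.
    data Descent (i : ℕ) : ∀ {u v} → Walk G u v → Set where
      stop : ∀ {u} → r u ≡ 0 → Descent i (done {u = u})
      next : ∀ {u v w} {e : T (adj G u v)} {p : Walk G v w} →
        lower r u v ≡ true → position (lower r u) v ≡ i → Descent i p → Descent i (step e p)

    lower⇒< : ∀ {u v} → lower r u v ≡ true → r v < r u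
    lower⇒< {u} {v} low = <ᵇ⇒< _ _ (≡true⇒T (proj₂ (∧-true {adj G u v} low)))

    -- The supply of lower neighbours is required at every vertex of positive rank, since the walk
    -- must be able to continue with the same index `i` until rank 0. The bound `m` on the rank
    -- drives the recursion.
    descend : ∀ i → (∀ v → 0 < r v → i < count (lower r v)) →
      ∀ m v → r v ≤ m → ∃ λ z → Σ (Walk G v z) (Descent i)
    descend i enough m v r≤m with r v ≟ 0
    descend i enough m v r≤m | yes r≡0 = v , done , stop r≡0
    descend i enough zero v r≤m | no r≢0 = contradiction (n≤0⇒n≡0 r≤m) r≢0
    descend i enough (suc m) v r≤m | no r≢0
      with w , low , pos ← select (lower r v) i (enough v (n≢0⇒n>0 r≢0))
      with z , p , des ← descend i enough m w (s≤s⁻¹ (≤-trans (lower⇒< low) r≤m)) =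
      z , step (≡true⇒T (proj₁ (∧-true low))) p , next low pos des

    module _ {i : ℕ} where

      descent-end : ∀ {u v} {p : Walk G u v} → Descent i p → r v ≡ 0
      descent-end (stop r≡0)   = r≡0
      descent-end (next _ _ d) = descent-end d

      descent-length : ∀ {u v} {p : Walk G u v} → Descent i p → wlength G p ≤ r u
      descent-length (stop _)       = z≤n
      descent-length (next low _ d) = ≤-trans (s≤s (descent-length d)) (lower⇒< low)

      descent-below : ∀ {u v} {p : Walk G u v} → Descent i p → All (λ x → r x ≤ r u) (vertices G p)
      descent-below (stop _)       = ≤-refl ∷ []
      descent-below (next low _ d) =
        ≤-refl ∷ All.map (λ x≤ → ≤-trans x≤ (<⇒≤ (lower⇒< low))) (descent-below d)

      -- All vertices after the first have strictly smaller rank, so the first cannot recur.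
      descent-path : ∀ {u v} {p : Walk G u v} → Descent i p → IsPath G p
      descent-path (stop _) = [] ∷ []
      descent-path (next low _ d) =
        All.map (λ { x≤ refl → <⇒≱ (lower⇒< low) x≤ }) (descent-below d) ∷ descent-path d

      descent-edge : ∀ {u v a b} {p : Walk G u v} → Descent i p → (a , b) LM.∈ edges G p →
        lower r a b ≡ true × position (lower r a) b ≡ i
      descent-edge (next low pos d) (here refl) = low , pos
      descent-edge (next _ _ d)     (there ab)  = descent-edge d ab

    -- An edge shared in the same direction has a single position at its tail, forcing `i ≡ j`. An
    -- edge shared in opposite directions would have to lower the rank both ways.
    descents-disjoint : ∀ {i j u v u′ v′} {p : Walk G u v} {q : Walk G u′ v′} →
      Descent i p → Descent j q → i ≢ j → EdgeDisjoint G p q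
    descents-disjoint dp dq i≢j a b ab =
      (λ ab′ → i≢j (trans (sym (proj₂ (descent-edge dp ab))) (proj₂ (descent-edge dq ab′)))) ,
      (λ ba → <-asym (lower⇒< (proj₁ (descent-edge dp ab))) (lower⇒< (proj₁ (descent-edge dq ba))))

-- Ranks obtained by peeling off vertices of low degree.

module Ranking {n : ℕ} (G : SimpleGraph n) (h : ℕ) (1≤h : 1 ≤ h) (mindeg : ∀ u → h ≤ deg G u) where
  open Volume G
  open Descents G

  -- Stated for all subsets, so that `heavy W` inherits it and the peeling can be iterated.
  Light : Subset n → Set
  Light W = ∀ {X} → X ⊆ W → 6 * vol G X X ≤ h * ∣ X ∣

  heavy : Subset n → Subset n
  heavy W = Vec.tabulate λ v → lookup W v ∧ (h <ᵇ 3 * degIn G W v)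

  lookup-heavy : ∀ W v → lookup (heavy W) v ≡ lookup W v ∧ (h <ᵇ 3 * degIn G W v)
  lookup-heavy W v = lookup∘tabulate _ v

  heavy⊆ : ∀ W → heavy W ⊆ W
  heavy⊆ W {v} v∈ = lookup⇒[]= v W (proj₁ (∧-true (trans (sym (lookup-heavy W v)) ([]=⇒lookup v∈))))

  -- Markov's inequality for degrees: each heavy vertex contributes more than `h / 3` to a volume of
  -- at most `h * ∣ W ∣ / 6`.
  heavy-halves : ∀ {W} → Light W → 2 * ∣ heavy W ∣ ≤ ∣ W ∣
  heavy-halves {W} light = *-cancelˡ-≤ h {{>-nonZero 1≤h}} (begin
    h * (2 * ∣ heavy W ∣)                  ≡⟨ e₁ h (∣ heavy W ∣) ⟩
    2 * (h * ∣ heavy W ∣)                  ≡⟨ cong (λ s → 2 * (h * s)) (∣S∣≡sum (heavy W)) ⟩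
    2 * (h * sum (χ (heavy W)))            ≡⟨ cong (2 *_) (*-distribˡ-sum h (χ (heavy W))) ⟩
    2 * sum (λ v → h * χ (heavy W) v)      ≤⟨ *-monoʳ-≤ 2 (sum-mono pointwise) ⟩
    2 * sum (λ v → 3 * degW v)             ≡⟨ cong (2 *_) (*-distribˡ-sum 3 degW) ⟨
    2 * (3 * sum degW)                     ≡⟨ *-assoc 2 3 (sum degW) ⟨
    6 * sum degW                           ≡⟨ cong (6 *_) (sumF≡sum degW) ⟨
    6 * vol G W W                          ≤⟨ light (λ x∈ → x∈) ⟩
    h * ∣ W ∣                              ∎)
    where
    open ≤-Reasoning
    degW : Fin n → ℕ
    degW v = if lookup W v then degIn G W v else 0
    e₁ : ∀ h x → h * (2 * x) ≡ 2 * (h * x)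
    e₁ = solve-∀
    entry : ∀ a d → h * ι (a ∧ (h <ᵇ 3 * d)) ≤ 3 * (if a then d else 0)
    entry false d = ≤-reflexive (*-zeroʳ h)
    entry true  d with h <ᵇ 3 * d in eq
    ... | false = ≤-trans (≤-reflexive (*-zeroʳ h)) z≤n
    ... | true  = ≤-trans (≤-reflexive (*-identityʳ h)) (<⇒≤ (<ᵇ⇒< h (3 * d) (≡true⇒T eq)))
    pointwise : ∀ v → h * χ (heavy W) v ≤ 3 * degW v
    pointwise v = subst (λ b → h * ι b ≤ 3 * degW v)
      (sym (lookup-heavy W v)) (entry (lookup W v) (degIn G W v))

  -- The number of rounds of peeling off the non-heavy vertices (the fuel f bounds it) in which v is present.
  rank : ℕ → Subset n → Fin n → ℕ
  rank zero    W v = 0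
  rank (suc f) W v = if lookup W v then suc (rank f (heavy W) v) else 0

  rank≤ : ∀ f W v → rank f W v ≤ f
  rank≤ zero    W v = z≤n
  rank≤ (suc f) W v with lookup W v
  ... | true  = s≤s (rank≤ f (heavy W) v)
  ... | false = z≤n

  rank≤suc : ∀ f W v → rank (suc f) W v ≤ suc (rank f (heavy W) v)
  rank≤suc f W v with lookup W v
  ... | true  = ≤-refl
  ... | false = z≤n

  rank-∉ : ∀ f W v → lookup W v ≡ false → rank f W v ≡ 0
  rank-∉ zero    W v _ = refl
  rank-∉ (suc f) W v eq rewrite eq = refl

  rank-∈ : ∀ f W v → lookup W v ≡ true → rank (suc f) W v ≡ suc (rank f (heavy W) v)
  rank-∈ f W v eq rewrite eq = refl

  deg-split : ∀ W v → deg G v ≡ degIn G W v + count (λ w → adj G v w ∧ not (lookup W w))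
  deg-split W v = begin
    deg G v ≡⟨ count≡sum {n} _ ⟩
    sum (λ w → ι (adj G v w)) ≡⟨ sum-cong-≗ (λ w → entry (lookup W w) (adj G v w)) ⟩
    sum (λ w → ι (lookup W w ∧ adj G v w) + ι (adj G v w ∧ not (lookup W w)))
      ≡⟨ ∑-distrib-+ (λ w → ι (lookup W w ∧ adj G v w)) (λ w → ι (adj G v w ∧ not (lookup W w))) ⟩
    sum (λ w → ι (lookup W w ∧ adj G v w)) + sum (λ w → ι (adj G v w ∧ not (lookup W w)))
      ≡⟨ cong₂ _+_ (count≡sum {n} _) (count≡sum {n} _) ⟨
    degIn G W v + count (λ w → adj G v w ∧ not (lookup W w)) ∎
    where
    open ≡-Reasoning
    entry : ∀ a b → ι b ≡ ι (a ∧ b) + ι (b ∧ not a)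
    entry true  true  = refl
    entry true  false = refl
    entry false true  = refl
    entry false false = refl

  -- Induction on the rounds. A heavy vertex takes its lower neighbours from the next round. Any
  -- other vertex of `W` has at most `h / 3` neighbours in `W`, so at least `2 * h / 3` lie outside
  -- and have rank 0. Halving keeps the size below `2 ^ f`, so `W` is empty when the fuel runs out.
  many-lower : ∀ f W → Light W → ∣ W ∣ < 2 ^ f → ∀ v → v ∈ W →
    2 * h ≤ 3 * count (lower (rank f W) v)
  many-lower zero W _ W<1 v v∈W = contradiction
    (≤-trans (≤-reflexive (sym (∣⁅x⁆∣≡1 v))) (p⊆q⇒∣p∣≤∣q∣
      (λ {x} x∈ → subst (_∈ W) (sym (x∈⁅y⁆⇒x≡y v x∈)) v∈W))) (<⇒≱ W<1)
  many-lower (suc f) W light W<2^ v v∈W with h <ᵇ 3 * degIn G W v in eq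
  ... | true = ≤-trans
        (many-lower f (heavy W) (λ {X} X⊆ → light {X} (λ {x} x∈ → heavy⊆ W (X⊆ x∈)))
          (*-cancelˡ-< 2 _ _ (≤-<-trans (heavy-halves light) W<2^)) v v∈heavy)
        -- Adding the current round raises the rank of `v` by exactly one and that of `w` by at most
        -- one, so the order is kept.
        (*-monoʳ-≤ 3 (count-mono λ w low → lower⁺ (rank (suc f) W) (proj₁ (∧-true low)) (begin-strict
          rank (suc f) W w           ≤⟨ rank≤suc f W w ⟩
          suc (rank f (heavy W) w)   <⟨ s≤s (lower⇒< (rank f (heavy W)) low) ⟩
          suc (rank f (heavy W) v)   ≡⟨ rank-∈ f W v ([]=⇒lookup v∈W) ⟨
          rank (suc f) W v           ∎)))
    where
    open ≤-Reasoning
    v∈heavy : v ∈ heavy W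
    v∈heavy = lookup⇒[]= v (heavy W) (trans (lookup-heavy W v) (cong₂ _∧_ ([]=⇒lookup v∈W) eq))
  ... | false = +-cancelˡ-≤ h _ _ (begin
    h + 2 * h                   ≤⟨ *-monoʳ-≤ 3 (mindeg v) ⟩
    3 * deg G v                 ≡⟨ cong (3 *_) (deg-split W v) ⟩
    3 * (degIn G W v + outside) ≡⟨ *-distribˡ-+ 3 (degIn G W v) outside ⟩
    3 * degIn G W v + 3 * outside
      ≤⟨ +-mono-≤ (≮⇒≥ {h} {3 * degIn G W v} (λ lt → subst T eq (<⇒<ᵇ lt))) (*-monoʳ-≤ 3 (count-mono outside⊆lower)) ⟩
    h + 3 * count (lower (rank (suc f) W) v) ∎)
    where
    open ≤-Reasoning
    outside = count (λ w → adj G v w ∧ not (lookup W w))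
    not-true : ∀ {b} → not b ≡ true → b ≡ false
    not-true {false} _ = refl
    outside⊆lower : ∀ w → adj G v w ∧ not (lookup W w) ≡ true → lower (rank (suc f) W) v w ≡ true
    outside⊆lower w out = lower⁺ (rank (suc f) W) (proj₁ (∧-true out))
      (subst₂ _<_ (sym (rank-∉ (suc f) W w (not-true (proj₂ (∧-true {adj G v w} out)))))
        (sym (rank-∈ f W v ([]=⇒lookup v∈W))) (s≤s z≤n))

  -- No neighbour can have rank below 0, whereas `many-lower` would supply at least one because
  -- `1 ≤ h`.
  rank≡0⇒∉ : ∀ f W → Light W → ∣ W ∣ < 2 ^ f → ∀ v → rank f W v ≡ 0 → v ∉ W
  rank≡0⇒∉ f W light W<2^ v r≡0 v∈W = <⇒≱ (*-mono-≤ {1} {2} (s≤s z≤n) 1≤h)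
    (≤-trans (many-lower f W light W<2^ v v∈W)
      (≤-reflexive (cong (3 *_) (trans (count≡sum {n} _) (trans (sum-cong-≗ λ w → none w) (sum-replicate-zero n))))))
    where
    none : ∀ w → ι (lower (rank f W) v w) ≡ 0
    none w with lower (rank f W) v w in low
    ... | false = refl
    ... | true  = contradiction (lower⇒< (rank f W) low) (subst (λ r → ¬ rank f W w < r) (sym r≡0) λ())

-- Not opened earlier, since it makes sections such as (m * n +_) ambiguous.
open import Data.Integer using (+_)

-- Rational inequalities by cross-multiplication.

nonNegᵘ-≤ : ∀ {a b d e} → a * suc e ≤ b * suc d → mkℚᵘ (+ a) d ≤ᵘ mkℚᵘ (+ b) e
nonNegᵘ-≤ {a} {b} {d} {e} le = *≤* (subst₂ ℤ._≤_ (ℤ.pos-* a (suc e)) (ℤ.pos-* b (suc d)) (ℤ.+≤+ le))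

nonNegᵘ-* : ∀ a b d e → mkℚᵘ (+ a) d *ᵘ mkℚᵘ (+ b) e ≡ mkℚᵘ (+ (a * b)) (e + d * suc e)
nonNegᵘ-* a b d e = cong (λ z → mkℚᵘ z (e + d * suc e)) (sym (ℤ.pos-* a b))

-- p is represented by a / suc d.
_≈_/suc_ : ℚ → ℕ → ℕ → Set
p ≈ a /suc d = toℚᵘ p ≃ᵘ mkℚᵘ (+ a) d

/-≈ : ∀ a d → ((+ a) /ℚ suc d) ≈ a /suc d
/-≈ a d = toℚᵘ-fromℚᵘ (mkℚᵘ (+ a) d)

*-≈ : ∀ {p q a b d e} → p ≈ a /suc d → q ≈ b /suc e → (p *ℚ q) ≈ (a * b) /suc (e + d * suc e)
*-≈ {p} {q} {a} {b} {d} {e} p≈ q≈ = ℚᵘ.≃-trans (toℚᵘ-homo-* p q)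
  (ℚᵘ.≃-trans (ℚᵘ.*-cong p≈ q≈) (ℚᵘ.≃-reflexive (nonNegᵘ-* a b d e)))

≤-≈ : ∀ {p q a b d e} → p ≈ a /suc d → q ≈ b /suc e → a * suc e ≤ b * suc d → p ≤ℚ q
≤-≈ p≈ q≈ le = toℚᵘ-cancel-≤ (ℚᵘ.≤-trans (ℚᵘ.≤-reflexive p≈)
  (ℚᵘ.≤-trans (nonNegᵘ-≤ le) (ℚᵘ.≤-reflexive (ℚᵘ.≃-sym q≈))))

module UnitFraction (d : ℕ) where

  -- Writing the denominator as `suc d` makes it visibly nonzero; an equation later identifies it
  -- with `8 * k`.
  φ : ℚ
  φ = (+ 1) /ℚ suc d

  φ*-≈ : ∀ a → (φ *ℚ ℕ→ℚ a) ≈ (1 * a) /suc (d * 1)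
  φ*-≈ a = *-≈ {φ} {ℕ→ℚ a} (/-≈ 1 d) (/-≈ a 0)

  φ*-≤ : ∀ a b → a ≤ b * suc d → φ *ℚ ℕ→ℚ a ≤ℚ ℕ→ℚ b
  φ*-≤ a b le = ≤-≈ (φ*-≈ a) (/-≈ b 0) (subst₂ _≤_ (e₁ a) (e₂ b d) le)
    where
    e₁ : ∀ a → a ≡ 1 * a * 1
    e₁ = solve-∀
    e₂ : ∀ b d → b * suc d ≡ b * suc (d * 1)
    e₂ = solve-∀

  1≤φ* : ∀ a → suc d ≤ a → 1ℚ ≤ℚ φ *ℚ ℕ→ℚ a
  1≤φ* a le = ≤-≈ (ℚᵘ.≃-refl {toℚᵘ 1ℚ}) (φ*-≈ a) (subst₂ _≤_ (e₁ d) (e₂ a) le)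
    where
    e₁ : ∀ d → suc d ≡ 1 * suc (d * 1)
    e₁ = solve-∀
    e₂ : ∀ a → a ≡ 1 * a * 1
    e₂ = solve-∀

  φ*⅓-≤ : ∀ a b → a ≤ 3 * suc d * b → (φ *ℚ ℕ→ℚ a) *ℚ ((+ 1) /ℚ 3) ≤ℚ ℕ→ℚ b
  φ*⅓-≤ a b le = ≤-≈ (*-≈ {φ *ℚ ℕ→ℚ a} {(+ 1) /ℚ 3} (φ*-≈ a) (/-≈ 1 2)) (/-≈ b 0)
    (subst₂ _≤_ (e₁ a) (e₂ b d) le)
    where
    e₁ : ∀ a → a ≡ 1 * a * 1 * 1
    e₁ = solve-∀
    e₂ : ∀ b d → 3 * suc d * b ≡ b * suc (2 + d * 1 * 3)
    e₂ = solve-∀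

-- The ceiling of `m / 3` with its universal property. The inequality makes the paths numerous
-- enough, and minimality turns a bound on three times a count into a bound on the count.
⌈/3⌉ : ∀ m → ∃ λ d → m ≤ 3 * d × (∀ c → m ≤ 3 * c → d ≤ c)
⌈/3⌉ zero                = 0 , z≤n , λ _ _ → z≤n
⌈/3⌉ (suc zero)          = 1 , s≤s z≤n , λ { (suc c) _ → s≤s z≤n }
⌈/3⌉ (suc (suc zero))    = 1 , s≤s (s≤s z≤n) , λ { (suc c) _ → s≤s z≤n }
⌈/3⌉ (suc (suc (suc m))) with d , m≤ , least ← ⌈/3⌉ m =
  suc d , subst (3 + m ≤_) (sym (*-suc 3 d)) (+-monoʳ-≤ 3 m≤) ,
  λ { (suc c) le → s≤s (least c (+-cancelˡ-≤ 3 _ _ (subst (3 + m ≤_) (*-suc 3 c) le))) }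

-- Assembly of the cores and the escaping paths.

module ExpandingCores {n : ℕ} (H : SimpleGraph n) (h k d : ℕ) (1≤h : 1 ≤ h) (1≤k : 1 ≤ k)
  (log≤k : ⌈log₂ n ⌉ ≤ k) (1+d≡8k : suc d ≡ 8 * k) (mindeg : ∀ u → h ≤ deg H u)
  (D : Decomposing.Decomposition H h k 1≤h 1≤k log≤k ⊤) where
  open Volume H
  open Cores H h k 1≤h 1≤k log≤k
  open Decomposing H h k 1≤h 1≤k log≤k
  open Decomposition D
  open UnitFraction d
  open Ranking H h 1≤h mindeg
  open Descents H

  n≤2^k : n ≤ 2 ^ k
  n≤2^k = ≤-trans (n≤2^⌈log₂n⌉ n) (^-monoʳ-≤ 2 log≤k)

  core-degree-bound : ∀ a → h ≤ 24 * k * a → (φ *ℚ ℕ→ℚ h) *ℚ ((+ 1) /ℚ 3) ≤ℚ ℕ→ℚ a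
  core-degree-bound a le = φ*⅓-≤ h a (subst (λ c → h ≤ c * a)
    (trans (*-assoc 3 8 k) (cong (3 *_) (sym 1+d≡8k))) le)

  IsExpandingCore : Subset n → Set
  IsExpandingCore K =
      (1 ≤ ∣ K ∣)
    × IsExpander H K φ
    × (∀ u → u ∈ K → (φ *ℚ ℕ→ℚ h) *ℚ ((+ 1) /ℚ 3) ≤ℚ ℕ→ℚ (degIn H K u))
    × (∀ u v → u ∈ K → v ∈ K →
         Σ (Walk H u v) λ w → WalkIn H K w × (φ *ℚ ℕ→ℚ (wlength H w) ≤ℚ ℕ→ℚ (24 * k)))
    × IsEdgeConnected H K ((φ *ℚ ℕ→ℚ h) *ℚ ((+ 1) /ℚ 3))

  core-expanding : ∀ {K} → Core K → IsExpandingCore K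
  core-expanding {K} core =
      proj₁ (Core.dense core)
    , (λ X X⊆K _ _ → φ*-≤ (vol H K X ⊓ vol H K (K ∖ X)) (cut H K X)
        (subst (vol H K X ⊓ vol H K (K ∖ X) ≤_) (cut*1+d X) (expands X⊆K)))
    , (λ u u∈K → core-degree-bound (degIn H K u) (core-degree core u∈K))
    -- The exponent `k + k` fits since the volume of `K` is at most the square of its size, and
    -- `∣ K ∣ ≤ n ≤ 2 ^ k`.
    , (λ u v u∈K v∈K → let w , inK , len = diameter (k + k) vol≤2^ u∈K v∈K in
         w , inK , φ*-≤ (wlength H w) (24 * k) (≤-trans len radius))
    , (λ X X⊆K 1≤X X<K → core-degree-bound (cut H K X) (core-cut core X⊆K 1≤X X<K))
    where
    expands : ∀ {X} → X ⊆ K → vol H K X ⊓ vol H K (K ∖ X) ≤ 8 * k * cut H K X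
    expands = core-expansion core
    cut*1+d : ∀ X → 8 * k * cut H K X ≡ cut H K X * suc d
    cut*1+d X = trans (*-comm (8 * k) (cut H K X)) (cong (cut H K X *_) (sym 1+d≡8k))
    positive : ∀ {u} → u ∈ K → 1 ≤ degIn H K u
    positive {u} u∈K = n≢0⇒n>0 λ deg≡0 → <⇒≱ 1≤h
      (≤-trans (core-degree core u∈K) (≤-reflexive (trans (cong (24 * k *_) deg≡0) (*-zeroʳ (24 * k)))))
    open Diameter H K (8 * k) {{subst NonZero 1+d≡8k _}} expands positive
    vol≤2^ : vol H K K ≤ 2 ^ (k + k)
    vol≤2^ = ≤-trans (vol≤∣∣*∣∣ K K) (≤-trans (*-mono-≤ size size) (≤-reflexive (sym (^-distribˡ-+-* 2 k k))))
      where
      size : ∣ K ∣ ≤ 2 ^ k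
      size = ≤-trans (∣p∣≤n K) n≤2^k
    -- The two radii add up to `4 * k * (8 * k)`; multiplication by `φ` leaves `4 * k`, below the
    -- allowed `24 * k`.
    radius : (k + k) * (8 * k) + (k + k) * (8 * k) ≤ 24 * k * suc d
    radius = ≤-trans (≤-reflexive (e k (8 * k))) (≤-trans (*-monoˡ-≤ (8 * k) (*-monoˡ-≤ k (m≤m+n 4 20)))
      (≤-reflexive (cong (24 * k *_) (sym 1+d≡8k))))
      where
      e : ∀ k p → (k + k) * p + (k + k) * p ≡ 4 * k * p
      e = solve-∀

  light : Light rest
  light {X} X⊆ = subst (λ e → 6 * e ≤ h * ∣ X ∣) (sym (vol≡pairs X X)) (sparse⇒low {X} (¬dense⇒sparse {X} (noDense X⊆)))

  -- One round more than `k` makes the inequality strict, as `many-lower` demands.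
  small : ∣ rest ∣ < 2 ^ suc k
  small = ≤-<-trans (≤-trans (∣p∣≤n rest) n≤2^k)
    (m<m+n (2 ^ k) (≤-trans (m^n>0 2 k) (m≤m+n (2 ^ k) 0)))

  r : Fin n → ℕ
  r = rank (suc k) rest

  rest-∈ : ∀ {v} → 0 < r v → v ∈ rest
  rest-∈ {v} 0<r with v ∈? rest
  ... | yes v∈ = v∈
  ... | no  v∉ = contradiction (rank-∉ (suc k) rest v (x∉⇒lookup v∉)) (m<n⇒n≢0 0<r)
    where
    x∉⇒lookup : v ∉ rest → lookup rest v ≡ false
    x∉⇒lookup v∉ with lookup rest v in eq
    ... | false = refl
    ... | true  = contradiction (lookup⇒[]= v rest eq) v∉

  r≡0⇒InUnion : ∀ {v} → r v ≡ 0 → InUnion cores v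
  r≡0⇒InUnion {v} r≡0 with cover {v} ∈⊤
  ... | inj₁ v∈ = contradiction v∈ (rank≡0⇒∉ (suc k) rest light small v r≡0)
  ... | inj₂ a  = Any⇒at a

  module Escape (u : Fin n) where
    m : ℕ
    m = proj₁ (⌈/3⌉ (2 * h))

    enough : ∀ v → 0 < r v → m ≤ count (lower r v)
    enough v 0<r = proj₂ (proj₂ (⌈/3⌉ (2 * h))) _ (many-lower (suc k) rest light small v (rest-∈ 0<r))

    walk : ∀ (i : Fin m) → ∃ λ z → Σ (Walk H u z) (Descent r (toℕ i))
    walk i = descend r (toℕ i) (λ v 0<r → ≤-trans (toℕ<n i) (enough v 0<r)) (r u) u ≤-refl

    path : Fin m → Σ (Fin n) λ z → Walk H u z
    path i = proj₁ (walk i) , proj₁ (proj₂ (walk i))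

    descent : ∀ i → Descent r (toℕ i) (proj₂ (path i))
    descent i = proj₂ (proj₂ (walk i))

    paths : List (Σ (Fin n) λ z → Walk H u z)
    paths = tabulate path

    many : 2 * h ≤ 3 * length paths
    many = subst (λ l → 2 * h ≤ 3 * l) (sym (length-tabulate path)) (proj₁ (proj₂ (⌈/3⌉ (2 * h))))

    short : All (λ p → InUnion cores (proj₁ p) × IsPath H (proj₂ p) × (wlength H (proj₂ p) ≤ 24 * k)) paths
    short = All.tabulate⁺ λ i → r≡0⇒InUnion (descent-end r (descent i)) , descent-path r (descent i) ,
      -- The length is at most the rank of `u`, hence at most `suc k`, and `1 ≤ k` gives
      -- `suc k ≤ k + k ≤ 24 * k`.
      ≤-trans (descent-length r (descent i)) (≤-trans (rank≤ (suc k) rest u)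
        (≤-trans (+-monoˡ-≤ k 1≤k) (+-monoʳ-≤ k (m≤n*m k 23))))

    EdgeDisjointPaths : (p q : Σ (Fin n) λ z → Walk H u z) → Set
    EdgeDisjointPaths p q = EdgeDisjoint H (proj₂ p) (proj₂ q)

    edgeDisjoint-sym : ∀ p q → EdgeDisjointPaths p q → EdgeDisjointPaths q p
    edgeDisjoint-sym p q dis a b ab = (λ ab′ → proj₁ (dis a b ab′) ab) , (λ ba → proj₂ (dis b a ba) ab)

    path-disjoint : ∀ {i j} → i ≢ j → EdgeDisjointPaths (path i) (path j)
    path-disjoint {i} {j} i≢j = descents-disjoint r {p = proj₂ (path i)} {q = proj₂ (path j)}
      (descent i) (descent j) (i≢j ∘ toℕ-injective)

    edgeDisjoint : ∀ i j → i ≢ j → EdgeDisjointPaths (at paths i) (at paths j)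
    edgeDisjoint = AllPairs⇒at {R = EdgeDisjointPaths} edgeDisjoint-sym {xs = paths}
      (AllPairs.tabulate⁺ {f = path} path-disjoint)

  number-of-cores : length cores * h ≤ 24 * (n * k)
  number-of-cores = ≤-trans few (≤-reflexive (trans (cong (24 * k *_) (∣⊤∣≡n n))
    (trans (*-assoc 24 k n) (cong (24 *_) (*-comm k n)))))

  cores-disjoint : PairwiseDisjoint cores
  cores-disjoint = AllPairs⇒at {R = Disjoint} (λ A B A∩B=∅ v v∈B v∈A → A∩B=∅ v v∈A v∈B) disjoint

  1≤φ*24k : 1ℚ ≤ℚ φ *ℚ ℕ→ℚ (24 * k)
  1≤φ*24k = 1≤φ* (24 * k) (subst (_≤ 24 * k) (sym 1+d≡8k) (*-monoˡ-≤ k (m≤m+n 8 16)))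

  expanding : All IsExpandingCore cores
  expanding = All.map core-expanding areCores

  escaping : ∀ u → ¬ InUnion cores u →
    Σ (List (Σ (Fin n) λ v → Walk H u v)) λ P →
        (2 * h ≤ 3 * length P)
      × All (λ p → InUnion cores (proj₁ p) × IsPath H (proj₂ p) × (wlength H (proj₂ p) ≤ 24 * k)) P
      × (∀ i j → i ≢ j → EdgeDisjoint H (proj₂ (at P i)) (proj₂ (at P j)))
  escaping u _ = paths , many , short , edgeDisjoint
    where open Escape u

theoremB1 : ∃ λ (C : ℕ) →
    ∀ (n h : ℕ) (H : SimpleGraph n) → 2 ≤ n → 1 ≤ h → (∀ u → h ≤ deg H u) →
    ∃ λ (F : List (Subset n)) → ∃ λ (φ : ℚ) →
    (length F * h ≤ C * (n * ⌈log₂ n ⌉))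
    × (1ℚ ≤ℚ φ *ℚ ℕ→ℚ (C * ⌈log₂ n ⌉))
    × PairwiseDisjoint F
    × All (λ K →
    (1 ≤ ∣ K ∣)
    × IsExpander H K φ
    × (∀ u → u ∈ K → (φ *ℚ ℕ→ℚ h) *ℚ ((+ 1) /ℚ 3) ≤ℚ ℕ→ℚ (degIn H K u))
    × (∀ u v → u ∈ K → v ∈ K →
    Σ (Walk H u v) λ w → WalkIn H K w × (φ *ℚ ℕ→ℚ (wlength H w) ≤ℚ ℕ→ℚ (C * ⌈log₂ n ⌉)))
    × IsEdgeConnected H K ((φ *ℚ ℕ→ℚ h) *ℚ ((+ 1) /ℚ 3))) F
    × (∀ u → ¬ InUnion F u →
    Σ (List (Σ (Fin n) λ v → Walk H u v)) λ P →
    (2 * h ≤ 3 * length P)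
    × All (λ p → InUnion F (proj₁ p) × IsPath H (proj₂ p)
    × (wlength H (proj₂ p) ≤ C * ⌈log₂ n ⌉)) P
    × (∀ i j → i ≢ j → EdgeDisjoint H (proj₂ (at P i)) (proj₂ (at P j))))
-- The constant 24 comes from `core-size` through the number of cores; the bounds `8 * k` for
-- `1 / φ`, `4 * k` for the scaled diameter and `suc k` for the path lengths fit below `24 * k`.
theoremB1 = 24 , λ n h H 2≤n 1≤h mindeg →
  let k    = ⌈log₂ n ⌉
      -- `2 ≤ n` makes the logarithm positive, so `8 * k` can serve as a denominator.
      1≤k  = ⌈log₂⌉-mono-≤ {2} {n} 2≤n
      8k≢0 = >-nonZero (≤-trans 1≤k (m≤n*m k 8))
      D    = Decomposing.decompose H h k 1≤h 1≤k ≤-refl ⊤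
      open ExpandingCores H h k (pred (8 * k)) 1≤h 1≤k ≤-refl (suc-pred (8 * k) {{8k≢0}}) mindeg D
  in
  Decomposing.Decomposition.cores D , UnitFraction.φ (pred (8 * k)) ,
  number-of-cores , 1≤φ*24k , cores-disjoint , expanding , escaping
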